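{- For positive integers $m,n$, the fan graph $F_{m,n}$ is Schur positive if and only if \[ (m,n)\in\{(1,n):n\in\{1,2,3,4\}\}\cup\{(2,n):n\in\{1,\dots,6\}\}\cup\{(3,4)\}. \]
   Context: The fan graph $F_{m,n}$ is the join $\overline{K_m}+P_n$: the disjoint union of $m$ pairwise non-adjacent vertices and a path on $n$ vertices, with every one of the $m$ vertices joined by an edge to every vertex of the path. The chromatic symmetric function of a graph $G$ is $X_G=\sum_{\kappa}\prod_{v\in V(G)}x_{\kappa(v)}$, summed over all proper colorings $\kappa:V(G)\to\{1,2,\dots\}$; $G$ is Schur positive if all coefficients of $X_G$ in the Schur basis are nonnegative. -}

module Defs where

open import Data.Bool using (Bool; true; false; _∧_; _∨_; not; if_then_else_)
open import Data.Nat using (ℕ; zero; suc; _+_; _*_; _≡ᵇ_; _<ᵇ_; _≤ᵇ_)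
open import Data.Fin using (Fin; toℕ; _≟_)
open import Data.Fin.Properties using () renaming (_≤?_ to _≤F?_; _<?_ to _<F?_)
open import Data.List using (List; []; _∷_; map; concatMap; allFin; filter; length)
open import Data.Bool.ListAction using (and)
open import Data.Nat.ListAction using (sum)
open import Data.Vec.Functional using () renaming (_∷_ to _∷ᶠ_)
open import Relation.Nullary.Decidable using (⌊_⌋)

Graph : ℕ → Set
Graph N = Fin N → Fin N → Bool

-- Fan graph F_{m,n} on vertices Fin (m + n): vertices 0..m-1 are the m
-- pairwise non-adjacent vertices; vertices m..m+n-1 form the path
-- (m, m+1, ..., m+n-1); every vertex < m is adjacent to every vertex ≥ m.
fanAdjℕ : ℕ → ℕ → ℕ → Bool
fanAdjℕ m a b =
  ((a <ᵇ m) ∧ (m ≤ᵇ b)) ∨ ((b <ᵇ m) ∧ (m ≤ᵇ a))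
  ∨ ((m ≤ᵇ a) ∧ (m ≤ᵇ b) ∧ (((a + 1) ≡ᵇ b) ∨ ((b + 1) ≡ᵇ a)))

fan : (m n : ℕ) → Graph (m + n)
fan m n i j = fanAdjℕ m (toℕ i) (toℕ j)

funsL : {B : Set} → (k : ℕ) → List B → List (Fin k → B)
funsL zero    xs = (λ ()) ∷ []
funsL (suc k) xs = concatMap (λ f → map (λ x → x ∷ᶠ f) xs) (funsL k xs)

countL : {A : Set} → (A → Bool) → List A → ℕ
countL p xs = length (filter (λ x → Data.Bool._≟_ (p x) true) xs)
  where import Data.Bool

allB : {k : ℕ} → (Fin k → Bool) → Bool
allB {k} p = and (map p (allFin k))

eqF : {k : ℕ} → Fin k → Fin k → Bool
eqF i j = ⌊ i ≟ j ⌋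

leF : {k : ℕ} → Fin k → Fin k → Bool
leF i j = ⌊ i ≤F? j ⌋

ltF : {k : ℕ} → Fin k → Fin k → Bool
ltF i j = ⌊ i <F? j ⌋

-- Chromatic symmetric function, restricted to N = |V| variables x_1..x_N
-- (indexed by Fin N).  A symmetric function of degree N is determined by
-- this restriction.  Monomial coefficient of x^α in X_G:
-- number of proper colorings κ : V → Fin N with |κ⁻¹(c)| = α c for all c.

isProper : {N : ℕ} → Graph N → (Fin N → Fin N) → Bool
isProper G κ = allB λ i → allB λ j → not (G i j) ∨ not (eqF (κ i) (κ j))

colorContent : {N : ℕ} → (Fin N → Fin N) → (α : Fin N → ℕ) → Bool
colorContent κ α = allB λ c → countL (λ v → eqF (κ v) c) (allFin _) ≡ᵇ α c

coeffX : {N : ℕ} → Graph N → (Fin N → ℕ) → ℕ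
coeffX {N} G α =
  countL (λ κ → isProper G κ ∧ colorContent κ α) (funsL N (allFin N))

-- Partitions of N, as weakly decreasing λ : Fin N → ℕ (padded by zeros)
-- with sum N.  Every partition of N has at most N parts.

isPartition : {N : ℕ} → (Fin N → ℕ) → Bool
isPartition {N} λ' =
  (allB λ i → allB λ j → not (ltF i j) ∨ (λ' j ≤ᵇ λ' i))
  ∧ (sum (map λ' (allFin N)) ≡ᵇ N)

partitions : (N : ℕ) → List (Fin N → ℕ)
partitions N =
  filter (λ p → Data.Bool._≟_ (isPartition p) true)
         (map (λ f i → toℕ (f i)) (funsL N (allFin (suc N))))
  where import Data.Bool

-- Semistandard Young tableaux of shape λ with entries in Fin N
-- (i.e. in {1,...,N}); a filling T r c (row r, column c) is used at cells
-- c < λ r, and is normalised to 0 outside the shape.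
inShape : {N : ℕ} → (Fin N → ℕ) → Fin N → Fin N → Bool
inShape λ' r c = toℕ c <ᵇ λ' r

isSSYT : {N : ℕ} → (Fin N → ℕ) → (Fin N → Fin N → Fin N) → Bool
isSSYT {suc N} λ' T =
  (allB λ r → allB λ c → inShape λ' r c ∨ eqF (T r c) Fin.zero)
  ∧ (allB λ r → allB λ c → allB λ c' →
       not (ltF c c' ∧ inShape λ' r c') ∨ leF (T r c) (T r c'))
  ∧ (allB λ r → allB λ r' → allB λ c →
       not (ltF r r' ∧ inShape λ' r' c) ∨ ltF (T r c) (T r' c))
  where import Data.Fin as Fin
isSSYT {zero} λ' T = true

tabContent : {N : ℕ} → (Fin N → ℕ) → (Fin N → Fin N → Fin N)
           → (Fin N → ℕ) → Bool
tabContent λ' T α = allB λ i →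
  sum (map (λ r → countL (λ c → inShape λ' r c ∧ eqF (T r c) i) (allFin _))
           (allFin _))
  ≡ᵇ α i

-- Kostka number K_{λ,α}: coefficient of x^α in s_λ(x_1,...,x_N).
kostka : {N : ℕ} → (Fin N → ℕ) → (Fin N → ℕ) → ℕ
kostka {N} λ' α =
  countL (λ T → isSSYT λ' T ∧ tabContent λ' T α)
         (funsL N (funsL N (allFin N)))

-- G is Schur positive: X_G = Σ_λ c_λ s_λ with all c_λ ≥ 0
-- (the Schur expansion is unique with integer coefficients, so this is
-- existence of ℕ-coefficients), compared coefficientwise on monomials x^α.
SchurPositive : {N : ℕ} → Graph N → Set
SchurPositive {N} G =
  Σ ((Fin N → ℕ) → ℕ) λ c → ∀ (α : Fin N → ℕ) →
    coeffX G α ≡ sum (map (λ μ → c μ * kostka μ α) (partitions N))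
  where
    open import Data.Product using (Σ)
    open import Relation.Binary.PropositionalEquality using (_≡_)

{-# OPTIONS --safe #-}
-- A semistandard tableau is the chain of shapes obtained by deleting its letters one
-- after another.  In such a chain, the shape between two neighbours o ⊂ q ranges
-- over a product of intervals.  Reflecting every interval (Bender–Knuth) shows that
-- the Kostka number K q α is symmetric in α, and moving towards the reflected point
-- shows that K q α > 0 is preserved when a unit is moved from a larger part of α to
-- a smaller one.  Hence, if X_G is Schur positive, the type of a stable partition can
-- be balanced in this way to give again the type of a stable partition.  Comparing
-- partitions into at most four blocks excludes all fans outside the list except
-- F_{3,6}, F_{4,6} and F_{3,8}, for which an inequality between a few Kostka numbers
-- contradicts the corresponding coefficients of X_G.  For the fans in the list the
-- Schur expansion is verified on all partitions of m + n; this is enough because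
-- both sides are symmetric in α.
module Submission where

-- The definitions enumerate functions: `partitions N` filters (N+1)^N of them, fillings have two
-- arguments, and functions can be compared only pointwise. So the counts are not evaluated as
-- given. Each is matched with one that can be: `K` and `parts` by pigeonhole arguments in both
-- directions, `fanCount` by recursion on the vertices.
--
-- Few blocks suffice because the fan is a join: a colour class lies either in the independent
-- vertices or in the path. A type is realisable only if some parts sum to m and the others sum to
-- n, each of the latter being at most (n+1)/2. The path is split into its two halves. The
-- independent vertices form one block if m is far from n/2, and otherwise two, one of them of size
-- 1 or 2. Balancing then makes m or n unattainable by such sums. For F_{3,6}, F_{4,6} and F_{3,8}
-- the types aimed at are still realisable, so supports are not enough and the sizes of coefficients
-- must be compared.

open import Defs
open import Data.Bool using (Bool; true; false; _∧_; _∨_; not; if_then_else_)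
import Data.Bool as Bool
open import Data.Bool.ListAction using (and)
open import Data.Bool.Properties using (T-≡; not-injective)
open import Data.Empty using (⊥-elim)
open import Data.Fin using (Fin; zero; suc; toℕ; fromℕ<; cast; _↑ˡ_; _↑ʳ_)
open import Data.Fin.Properties using (toℕ<n; toℕ-fromℕ<; toℕ-injective; cast-involutive; toℕ-↑ˡ;
  toℕ-↑ʳ) renaming (_≤?_ to _≤F?_; _<?_ to _<F?_; _≟_ to _≟F_)
import Data.List as List
open import Data.List using (List; []; _∷_; _++_; map; concatMap; cartesianProductWith; filter; length;
  tabulate; allFin; upTo; applyUpTo; applyDownFrom; replicate)
open import Data.List.Membership.Propositional using (_∈_; lose; find)
open import Data.List.Membership.Propositional.Properties using (∈-cartesianProductWith⁺;
  ∈-cartesianProductWith⁻; ∈-filter⁺; ∈-filter⁻; ∈-upTo⁺; ∈-upTo⁻; ∈-concatMap⁺; ∈-concatMap⁻; ∈-map⁺;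
  ∈-map⁻; ∈-length)
open import Data.List.Properties using (∷-injective; length-++; length-map; length-tabulate;
  length-applyDownFrom; lookup-tabulate; map-++; map-∘; map-cong; map-tabulate; reverse-applyUpTo;
  tabulate-cong; ≡-dec)
open import Data.List.Relation.Binary.Permutation.Propositional as Perm using (_↭_; ↭-refl; ↭-sym;
  ↭-trans; ↭-reflexive; ↭⇒↭ₛ)
open import Data.List.Relation.Binary.Permutation.Propositional.Properties using (++⁺ʳ; ↭-length;
  ↭-reverse)
import Data.List.Relation.Binary.Permutation.Setoid as SetoidPerm
import Data.List.Relation.Binary.Permutation.Setoid.Properties as SetoidPermProperties
open import Data.List.Relation.Unary.All as All using (All; []; _∷_)
import Data.List.Relation.Unary.All.Properties as All
open import Data.List.Relation.Unary.AllPairs as AllPairs using (AllPairs; []; _∷_)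
import Data.List.Relation.Unary.AllPairs.Properties as AllPairs
open import Data.List.Relation.Unary.Any as Any using (Any; here; there; _─_)
import Data.List.Relation.Unary.Any.Properties as Any
open import Data.List.Relation.Unary.Linked using (Linked; []; [-]; _∷_)
open import Data.List.Relation.Unary.Unique.Propositional using (Unique)
import Data.List.Relation.Unary.Unique.Propositional.Properties as Unique
open import Data.Maybe using (Maybe; just; nothing; maybe)
open import Data.Nat using (ℕ; zero; suc; _+_; _*_; _∸_; _⊔_; _⊓_; _≤_; _<_; z≤n; s≤s; s≤s⁻¹; _≟_; _≤?_;
  _<?_; _≡ᵇ_; _<ᵇ_; _≤ᵇ_; ⌊_/2⌋; ⌈_/2⌉; compare; less; equal; greater)
open import Data.Nat.ListAction using (sum)
open import Data.Nat.ListAction.Properties using (sum-++; sum-↭)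
open import Data.Nat.Properties
open import Data.Nat.Tactic.RingSolver using (solve-∀)
open import Data.Product using (_×_; _,_; proj₁; proj₂; ∃)
open import Data.Sum using (_⊎_; inj₁; inj₂)
import Data.Vec as Vec
open import Data.Vec using (Vec; []; _∷_; lookup; _[_]≔_)
open import Data.Vec.Functional using () renaming (_∷_ to _∷ᶠ_)
open import Data.Vec.Properties using (lookup∘update; lookup∘update′; lookup∘tabulate)
open import Function using (_∘_; id)
open import Function.Bundles using (_⇔_; mk⇔; Equivalence; Inverse)
open import Relation.Binary.Construct.Flip.EqAndOrd using () renaming
  (decTotalOrder to flip-decTotalOrder)
open import Relation.Binary.Definitions using (tri<; tri≈; tri>)
open import Relation.Binary.PropositionalEquality using (_≡_; _≢_; refl; sym; trans; cong; cong₂; subst;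
  subst₂; setoid; module ≡-Reasoning)
open import Relation.Nullary using (¬_; Dec; yes; no)
open import Relation.Nullary.Decidable using (⌊_⌋)
open import Algebra.Properties.CommutativeSemigroup +-commutativeSemigroup using (x∙yz≈y∙xz;
  interchange)
open import Data.List.Sort (flip-decTotalOrder ≤-decTotalOrder) using (sort; sort-↭; sort-↗)

-- Sums and counts over finite sets

module _ {A B : Set} where

  ─⁺ : {P R : B → Set} {vs : List B} (p : Any P vs) → Any R vs →
       (∀ {v} → P v → ¬ R v) → Any R (vs ─ p)
  ─⁺ (here px) (here rx) d = ⊥-elim (d px rx)
  ─⁺ (here px) (there r) d = r
  ─⁺ (there p) (here rx) d = here rx
  ─⁺ (there p) (there r) d = there (─⁺ p r d)

  sum-─ : {P : B → Set} (G : B → ℕ) {vs : List B} (p : Any P vs) →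
          sum (map G vs) ≡ G (Any.lookup p) + sum (map G (vs ─ p))
  sum-─ G (here px) = refl
  sum-─ G {v ∷ vs} (there p) = begin
    G v + sum (map G vs)                                   ≡⟨ cong (G v +_) (sum-─ G p) ⟩
    G v + (G (Any.lookup p) + sum (map G (vs ─ p)))        ≡⟨ x∙yz≈y∙xz (G v) (G (Any.lookup p)) _ ⟩
    G (Any.lookup p) + (G v + sum (map G (vs ─ p)))        ∎
    where open ≡-Reasoning

  -- Induction on `us`: the partner of `u` is deleted from `vs`, and disjointness keeps the partners
  -- of the other elements available. A relation takes the place of an injection because an
  -- enumerated function matches a constructed one only pointwise. The weights let the same lemma
  -- compare sums as well as lengths.
  pigeonhole : (Q : A → B → Set) (F : A → ℕ) (G : B → ℕ) →
    (∀ {u v} → Q u v → F u ≤ G v) → {us : List A} {vs : List B} →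
    All (λ u → Any (Q u) vs) us →
    AllPairs (λ u u' → ∀ v → Q u v → ¬ Q u' v) us →
    sum (map F us) ≤ sum (map G vs)
  pigeonhole Q F G F≤G [] [] = z≤n
  pigeonhole Q F G F≤G {u ∷ us} {vs} (p ∷ ps) (d ∷ ds) = begin
    F u + sum (map F us)
      ≤⟨ +-mono-≤ (F≤G (Any.lookup-result p))
           (pigeonhole Q F G F≤G
             (All.zipWith (λ { (q , e) → ─⁺ p q (λ {v} → e v) }) (ps , d)) ds) ⟩
    G (Any.lookup p) + sum (map G (vs ─ p))
      ≡⟨ sum-─ G p ⟨
    sum (map G vs) ∎
    where open ≤-Reasoning

sum-map-1 : {A : Set} (xs : List A) → sum (map (λ _ → 1) xs) ≡ length xs
sum-map-1 [] = refl
sum-map-1 (x ∷ xs) = cong suc (sum-map-1 xs)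

sum-map-0 : ∀ {A : Set} (xs : List A) → sum (map (λ _ → 0) xs) ≡ 0
sum-map-0 [] = refl
sum-map-0 (x ∷ xs) = sum-map-0 xs

sum-map-* : ∀ {A : Set} w (f : A → ℕ) xs → w * sum (map f xs) ≡ sum (map (λ x → w * f x) xs)
sum-map-* w f [] = *-zeroʳ w
sum-map-* w f (x ∷ xs) = trans (*-distribˡ-+ w (f x) _) (cong (w * f x +_) (sum-map-* w f xs))

sum-map-+ : ∀ {A : Set} (f g : A → ℕ) xs → sum (map f xs) + sum (map g xs) ≡ sum
  (map (λ x → f x + g x) xs)
sum-map-+ f g [] = refl
sum-map-+ f g (x ∷ xs) = trans (interchange (f x) _ (g x) _) (cong (f x + g x +_) (sum-map-+ f g xs))

sum-map-≤ : ∀ {A : Set} {P : A → Set} {f g : A → ℕ} → (∀ {x} → P x → f x ≤ g x) → ∀ {xs} → All P xs →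
  sum (map f xs) ≤ sum (map g xs)
sum-map-≤ h [] = z≤n
sum-map-≤ h (p ∷ ps) = +-mono-≤ (h p) (sum-map-≤ h ps)

sum-map-pos : ∀ {A : Set} (f : A → ℕ) xs → 0 < sum (map f xs) → Any (λ x → 0 < f x) xs
sum-map-pos f (x ∷ xs) l with f x in e
... | zero = there (sum-map-pos f xs l)
... | suc _ = here (subst (0 <_) (sym e) (s≤s z≤n))

sum-map-zero : ∀ {A : Set} (f : A → ℕ) {xs} → sum (map f xs) ≡ 0 → All (λ x → f x ≡ 0) xs
sum-map-zero f {[]} e = []
sum-map-zero f {x ∷ xs} e = m+n≡0⇒m≡0 (f x) e ∷ sum-map-zero f (m+n≡0⇒n≡0 (f x) e)

map-cong-All : ∀ {A : Set} {P : A → Set} {f g : A → ℕ} → (∀ {x} → P x → f x ≡ g x) → ∀ {xs} → All P xs →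
  map f xs ≡ map g xs
map-cong-All h [] = refl
map-cong-All h (p ∷ ps) = cong₂ _∷_ (h p) (map-cong-All h ps)

length-≤ : {A B : Set} (Q : A → B → Set) {us : List A} {vs : List B} →
  All (λ u → Any (Q u) vs) us →
  AllPairs (λ u u' → ∀ v → Q u v → ¬ Q u' v) us → length us ≤ length vs
length-≤ Q {us} {vs} a d = subst₂ _≤_ (sum-map-1 us) (sum-map-1 vs)
  (pigeonhole Q (λ _ → 1) (λ _ → 1) (λ _ → ≤-refl) a d)

filterᵇ-All : {A : Set} (p : A → Bool) (xs : List A) →
  All (λ x → p x ≡ true) (filter (λ x → p x Bool.≟ true) xs)
filterᵇ-All p xs = All.all-filter (λ x → p x Bool.≟ true) xs

filterᵇ-Any : {A : Set} {Q : A → Set} (p : A → Bool) {xs : List A} →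
  Any (λ x → p x ≡ true × Q x) xs → Any Q (filter (λ x → p x Bool.≟ true) xs)
filterᵇ-Any p {x ∷ xs} a with p x Bool.≟ true | a
... | yes _ | here (_ , q) = here q
... | yes _ | there a' = there (filterᵇ-Any p a')
... | no ¬e | here (e , _) = ⊥-elim (¬e e)
... | no _ | there a' = filterᵇ-Any p a'

AllPairs-with : {A : Set} {P : A → Set} {R S : A → A → Set} →
  (∀ {x y} → P x → P y → R x y → S x y) → {xs : List A} → All P xs → AllPairs R xs → AllPairs S xs
AllPairs-with f [] [] = []
AllPairs-with f (p ∷ ps) (r ∷ rs) =
  All.zipWith (λ (q , e) → f p q e) (ps , r) ∷ AllPairs-with f ps rs

module _ {B : Set} (_≈_ : B → B → Set) where

  -- Together with `funsL-complete` this says that, for a suitable `xs`, every function is listed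
  -- exactly once up to pointwise equality. `_≈_` is a parameter so that fillings can be treated by
  -- two applications, to the rows and then to the families of rows.
  funsL-apart : ∀ k {xs} → AllPairs (λ x y → ¬ x ≈ y) xs →
    AllPairs (λ f g → ¬ (∀ i → f i ≈ g i)) (funsL k xs)
  funsL-apart zero a = [] ∷ []
  funsL-apart (suc k) {xs} a = AllPairs.concat⁺
    (All.map⁺ (All.universal (λ f → AllPairs.map⁺ (AllPairs.map (λ x≉y e → x≉y (e zero)) a))
      (funsL k xs)))
    (AllPairs.map⁺ (AllPairs.map
       (λ f≉g → All.map⁺ (All.universal (λ x → All.map⁺ (All.universal (λ y e → f≉g (e ∘ suc)) xs)) xs))
       (funsL-apart k a)))

  funsL-complete : ∀ k {xs} (f : Fin k → B) → (∀ i → Any (f i ≈_) xs) →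
    Any (λ g → ∀ i → f i ≈ g i) (funsL k xs)
  funsL-complete zero f a = here (λ ())
  funsL-complete (suc k) {xs} f a = Any.concat⁺ (Any.map⁺
    (Any.map (λ e → Any.map⁺ (Any.map (λ e0 → λ { zero → e0 ; (suc i) → e i }) (a zero)))
      (funsL-complete k (f ∘ suc) (a ∘ suc))))

allFin-apart : ∀ k → AllPairs (λ (i j : Fin k) → ¬ i ≡ j) (allFin k)
allFin-apart k = AllPairs.tabulate⁺ (λ i≢j → i≢j)

allFin-complete : ∀ {k} (i : Fin k) → Any (i ≡_) (allFin k)
allFin-complete i = Any.tabulate⁺ i refl

-- Boolean tests and the propositions they decide

∧-true : ∀ {a b} → a ∧ b ≡ true → a ≡ true × b ≡ true
∧-true {true} e = refl , e

∧-true⁻ : ∀ {a b} → a ≡ true → b ≡ true → a ∧ b ≡ true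
∧-true⁻ refl e = e

allB⁺ : ∀ {k} (p : Fin k → Bool) → (∀ i → p i ≡ true) → allB p ≡ true
allB⁺ {zero} p h = refl
allB⁺ {suc k} p h = ∧-true⁻ (h zero)
  (trans (cong and (trans (map-tabulate suc p) (sym (map-tabulate id (p ∘ suc)))))
    (allB⁺ (p ∘ suc) (h ∘ suc)))

allB⁻ : ∀ {k} (p : Fin k → Bool) → allB p ≡ true → ∀ i → p i ≡ true
allB⁻ {suc k} p e zero = proj₁ (∧-true e)
allB⁻ {suc k} p e (suc i) = allB⁻ (p ∘ suc)
  (trans (cong and (trans (map-tabulate id (p ∘ suc)) (sym (map-tabulate suc p)))) (proj₂ (∧-true e))) i

false≢true : ¬ false ≡ true
false≢true ()

∨-introˡ : ∀ {a b} → a ≡ true → a ∨ b ≡ true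
∨-introˡ refl = refl

∨-introʳ : ∀ {a b} → b ≡ true → a ∨ b ≡ true
∨-introʳ {true} e = refl
∨-introʳ {false} e = e

∨-elim : ∀ {a b} → a ∨ b ≡ true → a ≡ true ⊎ b ≡ true
∨-elim {true} e = inj₁ refl
∨-elim {false} e = inj₂ e

⇒-true : ∀ {a b} → not a ∨ b ≡ true → a ≡ true → b ≡ true
⇒-true {true} e refl = e

⇒-true⁻ : ∀ {a b} → (a ≡ true → b ≡ true) → not a ∨ b ≡ true
⇒-true⁻ {false} f = refl
⇒-true⁻ {true} f = f refl

not-true : ∀ {a} → not a ≡ true → ¬ a ≡ true
not-true {false} e ()

not-true⁻ : ∀ {a} → ¬ a ≡ true → not a ≡ true
not-true⁻ {false} f = refl
not-true⁻ {true} f = ⊥-elim (f refl)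

dec-true : {P : Set} (d : Dec P) → ⌊ d ⌋ ≡ true → P
dec-true (yes p) e = p

dec-true⁻ : {P : Set} (d : Dec P) → P → ⌊ d ⌋ ≡ true
dec-true⁻ (yes _) p = refl
dec-true⁻ (no ¬p) p = ⊥-elim (¬p p)

⇔→≡ : ∀ {a b} → (a ≡ true → b ≡ true) → (b ≡ true → a ≡ true) → a ≡ b
⇔→≡ {true} {b} f g = sym (f refl)
⇔→≡ {false} {true} f g = g refl
⇔→≡ {false} {false} f g = refl

<ᵇ-true : ∀ {a b} → (a <ᵇ b) ≡ true → a < b
<ᵇ-true {a} {b} e = <ᵇ⇒< a b (Equivalence.from T-≡ e)

<ᵇ-true⁻ : ∀ {a b} → a < b → (a <ᵇ b) ≡ true
<ᵇ-true⁻ a<b = Equivalence.to T-≡ (<⇒<ᵇ a<b)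

≤ᵇ-true : ∀ {a b} → (a ≤ᵇ b) ≡ true → a ≤ b
≤ᵇ-true {a} {b} e = ≤ᵇ⇒≤ a b (Equivalence.from T-≡ e)

≤ᵇ-true⁻ : ∀ {a b} → a ≤ b → (a ≤ᵇ b) ≡ true
≤ᵇ-true⁻ a≤b = Equivalence.to T-≡ (≤⇒≤ᵇ a≤b)

≡ᵇ-true : ∀ {a b} → (a ≡ᵇ b) ≡ true → a ≡ b
≡ᵇ-true {a} {b} e = ≡ᵇ⇒≡ a b (Equivalence.from T-≡ e)

≡ᵇ-true⁻ : ∀ {a b} → a ≡ b → (a ≡ᵇ b) ≡ true
≡ᵇ-true⁻ {a} {b} e = Equivalence.to T-≡ (≡⇒≡ᵇ a b e)

-- Counts as sums of indicators

𝟙 : Bool → ℕ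
𝟙 true = 1
𝟙 false = 0

𝟙-mono : ∀ {a b} → (a ≡ true → b ≡ true) → 𝟙 a ≤ 𝟙 b
𝟙-mono {true} f rewrite f refl = ≤-refl
𝟙-mono {false} f = z≤n

countL-sum : {A : Set} (p : A → Bool) (xs : List A) → countL p xs ≡ sum (map (𝟙 ∘ p) xs)
countL-sum p [] = refl
countL-sum p (x ∷ xs) with p x
... | true = cong suc (countL-sum p xs)
... | false = countL-sum p xs

countL-cong : ∀ {A : Set} {p q : A → Bool} → (∀ x → p x ≡ q x) → ∀ xs → countL p xs ≡ countL q xs
countL-cong {p = p} {q} h xs =
  trans (countL-sum p xs) (trans (cong sum (map-cong (λ x → cong 𝟙 (h x)) xs)) (sym (countL-sum q xs)))

countL-false : ∀ {A : Set} (xs : List A) → countL (λ _ → false) xs ≡ 0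
countL-false [] = refl
countL-false (x ∷ xs) = countL-false xs

-- Abstract, so that unification recovers f from ∑ f and p from # p.
abstract
  ∑ : ∀ {k} → (Fin k → ℕ) → ℕ
  ∑ f = sum (tabulate f)

  # : ∀ {k} → (Fin k → Bool) → ℕ
  # p = ∑ (𝟙 ∘ p)

  ∑-def : ∀ {k} (f : Fin k → ℕ) → ∑ f ≡ sum (tabulate f)
  ∑-def f = refl

  ∑-zero : (f : Fin 0 → ℕ) → ∑ f ≡ 0
  ∑-zero f = refl

  ∑-suc : ∀ {k} (f : Fin (suc k) → ℕ) → ∑ f ≡ f zero + ∑ (f ∘ suc)
  ∑-suc f = refl

  #-def : ∀ {k} (p : Fin k → Bool) → # p ≡ ∑ (𝟙 ∘ p)
  #-def p = refl

  #-suc : ∀ {k} (p : Fin (suc k) → Bool) → # p ≡ 𝟙 (p zero) + # (p ∘ suc)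
  #-suc p = refl

  sum-allFin : ∀ {k} (f : Fin k → ℕ) → sum (map f (allFin k)) ≡ ∑ f
  sum-allFin f = cong sum (map-tabulate id f)

  countL-# : ∀ {k} (p : Fin k → Bool) → countL p (allFin k) ≡ # p
  countL-# p = trans (countL-sum p (allFin _)) (sum-allFin (𝟙 ∘ p))

  ∑-cong : ∀ {k} {f g : Fin k → ℕ} → (∀ i → f i ≡ g i) → ∑ f ≡ ∑ g
  ∑-cong h = cong sum (tabulate-cong h)

  ∑-mono : ∀ {k} {f g : Fin k → ℕ} → (∀ i → f i ≤ g i) → ∑ f ≤ ∑ g
  ∑-mono {zero} h = z≤n
  ∑-mono {suc k} h = +-mono-≤ (h zero) (∑-mono (h ∘ suc))

  ∑-+ : ∀ {k} (f g : Fin k → ℕ) → ∑ (λ i → f i + g i) ≡ ∑ f + ∑ g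
  ∑-+ {zero} f g = refl
  ∑-+ {suc k} f g = trans (cong (f zero + g zero +_) (∑-+ (f ∘ suc) (g ∘ suc)))
    (interchange (f zero) (g zero) (∑ (f ∘ suc)) (∑ (g ∘ suc)))

  ∑-0 : ∀ k → ∑ {k} (λ _ → 0) ≡ 0
  ∑-0 zero = refl
  ∑-0 (suc k) = ∑-0 k

  ∑-1 : ∀ k → ∑ {k} (λ _ → 1) ≡ k
  ∑-1 zero = refl
  ∑-1 (suc k) = cong suc (∑-1 k)

  ∑-swap : ∀ {k l} (f : Fin k → Fin l → ℕ) → ∑ (λ i → ∑ (f i)) ≡ ∑ (λ j → ∑ (λ i → f i j))
  ∑-swap {zero} {l} f = sym (∑-0 l)
  ∑-swap {suc k} f = trans (cong (∑ (f zero) +_) (∑-swap (f ∘ suc)))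
    (sym (∑-+ (f zero) (λ j → ∑ (λ i → f (suc i) j))))

  #-+ : ∀ {k} {p q r : Fin k → Bool} → (∀ i → 𝟙 (p i) ≡ 𝟙 (q i) + 𝟙 (r i)) → # p ≡ # q + # r
  #-+ {q = q} {r} h = trans (∑-cong h) (∑-+ (𝟙 ∘ q) (𝟙 ∘ r))

  #-mono : ∀ {k} {p q : Fin k → Bool} → (∀ i → p i ≡ true → q i ≡ true) → # p ≤ # q
  #-mono h = ∑-mono (λ i → 𝟙-mono (h i))

  #-cong : ∀ {k} {p q : Fin k → Bool} → (∀ i → p i ≡ q i) → # p ≡ # q
  #-cong h = ∑-cong (λ i → cong 𝟙 (h i))

  #-false : ∀ {k} {p : Fin k → Bool} → (∀ i → ¬ p i ≡ true) → # p ≡ 0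
  #-false {k} h = trans (#-cong (λ i → not-injective (trans (not-true⁻ (h i)) refl))) (∑-0 k)

  #-<ᵇ : ∀ {k} a → a ≤ k → # {k} (λ c → toℕ c <ᵇ a) ≡ a
  #-<ᵇ {k} zero _ = ∑-0 k
  #-<ᵇ {suc k} (suc a) (s≤s a≤k) = cong suc (#-<ᵇ a a≤k)

  #-initial : ∀ {k} (p : Fin k → Bool) → (∀ {i j} → toℕ i ≤ toℕ j → p j ≡ true → p i ≡ true) →
    ∀ i → (p i ≡ true → toℕ i < # p) × (toℕ i < # p → p i ≡ true)
  #-initial {suc k} p down i with p zero in e
  #-initial {suc k} p down zero | true = (λ _ → s≤s z≤n) , λ _ → e
  #-initial {suc k} p down (suc i) | true =
    let f , g = #-initial (p ∘ suc) (λ l → down (s≤s l)) i in (λ t → s≤s (f t)) , λ { (s≤s l) → g l }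
  #-initial {suc k} p down i | false =
    (λ t → ⊥-elim (none i t)) , λ l → ⊥-elim (n≮0 (subst (toℕ i <_) (#-false (λ j → none (suc j))) l))
    where
      none : ∀ j → ¬ p j ≡ true
      none j t with trans (sym e) (down z≤n t)
      ... | ()

-- Horizontal strips and the Bender–Knuth involution

hd : List ℕ → ℕ
hd [] = 0
hd (x ∷ _) = x

-- Strip p q: q / p is a horizontal strip.
data Strip : List ℕ → List ℕ → Set where
  [] : Strip [] []
  _∷_ : ∀ {y p x q} → hd q ≤ y × y ≤ x → Strip p q → Strip (y ∷ p) (x ∷ q)

below : List ℕ → List (List ℕ)
below [] = [] ∷ []
below (x ∷ q) = cartesianProductWith _∷_ (filter (hd q ≤?_) (upTo (suc x))) (below q)

∈-below⁺ : ∀ {p q} → Strip p q → p ∈ below q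
∈-below⁺ [] = here refl
∈-below⁺ {q = x ∷ q} ((l , u) ∷ s) =
  ∈-cartesianProductWith⁺ _∷_ (∈-filter⁺ (hd q ≤?_) (∈-upTo⁺ (s≤s u)) l) (∈-below⁺ s)

∈-below⁻ : ∀ {p} q → p ∈ below q → Strip p q
∈-below⁻ [] (here refl) = []
∈-below⁻ (x ∷ q) m
  with y , p , y∈ , p∈ , refl ← ∈-cartesianProductWith⁻ _∷_ (filter (hd q ≤?_) (upTo (suc x)))
    (below q) m
  with y∈′ , l ← ∈-filter⁻ (hd q ≤?_) {xs = upTo (suc x)} y∈
  = (l , s≤s⁻¹ (∈-upTo⁻ y∈′)) ∷ ∈-below⁻ q p∈

below-unique : ∀ q → Unique (below q)
below-unique [] = [] ∷ []
below-unique (x ∷ q) = Unique.cartesianProductWith⁺ _∷_ ∷-injective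
  (Unique.filter⁺ (hd q ≤?_) (Unique.upTo⁺ (suc x))) (below-unique q)

-- Chain q α ks: ks is a semistandard tableau of shape q, recorded as the chain
-- of shapes obtained by deleting the letters from the largest to the smallest;
-- α lists the multiplicities of the letters in the same order.
data Chain : List ℕ → List ℕ → List (List ℕ) → Set where
  done : ∀ {q} → All (_≡ 0) q → Chain q [] []
  step : ∀ {p q a α ks} → Strip p q → sum p + a ≡ sum q → Chain p α ks → Chain q (a ∷ α) (p ∷ ks)

removals : List ℕ → ℕ → List (List ℕ)
removals q a = filter (λ p → sum p + a ≟ sum q) (below q)

chains : List ℕ → List ℕ → List (List (List ℕ))
chains q [] with All.all? (_≟ 0) q
... | yes _ = [] ∷ []
... | no _ = []
chains q (a ∷ α) = concatMap (λ p → map (p ∷_) (chains p α)) (removals q a)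

∈-chains⁺ : ∀ {q α ks} → Chain q α ks → ks ∈ chains q α
∈-chains⁺ {q} (done z) with All.all? (_≟ 0) q
... | yes _ = here refl
... | no ¬z = ⊥-elim (¬z z)
∈-chains⁺ {q} {a ∷ α} (step {p} s e c) = ∈-concatMap⁺ (λ p → map (p ∷_) (chains p α))
  (lose (∈-filter⁺ (λ p → sum p + a ≟ sum q) (∈-below⁺ s) e) (∈-map⁺ (p ∷_) (∈-chains⁺ c)))

∈-chains⁻ : ∀ q α {ks} → ks ∈ chains q α → Chain q α ks
∈-chains⁻ q [] m with All.all? (_≟ 0) q | m
... | yes z | here refl = done z
∈-chains⁻ q (a ∷ α) m
  with p , p∈ , m′ ← find (∈-concatMap⁻ (λ p → map (p ∷_) (chains p α)) {xs = removals q a} m)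
  with p∈′ , e ← ∈-filter⁻ (λ p → sum p + a ≟ sum q) {xs = below q} p∈
  with ks , ks∈ , refl ← ∈-map⁻ (p ∷_) m′
  = step (∈-below⁻ q p∈′) e (∈-chains⁻ p α ks∈)

chains-unique : ∀ q α → Unique (chains q α)
chains-unique q [] with All.all? (_≟ 0) q
... | yes _ = [] ∷ []
... | no _ = []
chains-unique q (a ∷ α) = AllPairs.concat⁺
  (All.map⁺ (All.universal (λ p → Unique.map⁺ (proj₂ ∘ ∷-injective) (chains-unique p α))
    (removals q a)))
  (AllPairs.map⁺ (AllPairs.map
    (λ {p} {p′} p≢p′ → All.map⁺ (All.universal
       (λ ks → All.map⁺ (All.universal (λ ks′ e → p≢p′ (proj₁ (∷-injective e))) (chains p′ α)))
         (chains p α)))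
    (Unique.filter⁺ (λ p → sum p + a ≟ sum q) (below-unique q))))

chains-All : ∀ q α → All (Chain q α) (chains q α)
chains-All q α = All.tabulate (∈-chains⁻ q α)

K : List ℕ → List ℕ → ℕ
K q α = length (chains q α)

K-pos : ∀ {q α ks} → Chain q α ks → 0 < K q α
K-pos c = ∈-length (∈-chains⁺ c)

K-pos⁻ : ∀ q α → 0 < K q α → ∃ (Chain q α)
K-pos⁻ q α h with chains q α | chains-All q α
... | ks ∷ _ | c ∷ _ = ks , c

-- Mid h q o p: o ⊂ p ⊂ q is a chain of two horizontal strips.  Given o and q the
-- entries of p range over independent intervals; h bounds the first one.
data Mid : ℕ → List ℕ → List ℕ → List ℕ → Set where
  [] : ∀ {h} → Mid h [] [] []
  _∷_ : ∀ {h x q z o y p} → z ⊔ hd q ≤ y × y ≤ x ⊓ h → Mid z q o p → Mid h (x ∷ q) (z ∷ o) (y ∷ p)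

mid : ∀ {h q o p} → Strip p q → Strip o p → hd p ≤ h → Mid h q o p
mid [] [] _ = []
mid ((l , u) ∷ s) ((l′ , u′) ∷ s′) y≤h = (⊔-lub u′ l , ⊓-glb u y≤h) ∷ mid s s′ l′

mid⁻ : ∀ {h q o p} → Mid h q o p → Strip p q × Strip o p × hd p ≤ h
mid⁻ [] = [] , [] , z≤n
mid⁻ {h} {x ∷ q} {z ∷ o} ((l , u) ∷ m) with s , s′ , b ← mid⁻ m =
  (m⊔n≤o⇒n≤o z (hd q) l , ≤-trans u (m⊓n≤m x h)) ∷ s , (b , m⊔n≤o⇒m≤o z (hd q) l) ∷ s′ ,
  ≤-trans u (m⊓n≤n x h)

-- The Bender–Knuth involution.
reflect : ℕ → List ℕ → List ℕ → List ℕ → List ℕ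
reflect h (x ∷ q) (z ∷ o) (y ∷ p) = ((z ⊔ hd q) + (x ⊓ h) ∸ y) ∷ reflect z q o p
reflect h _ _ _ = []

reflect-mid : ∀ {h q o p} → Mid h q o p → Mid h q o (reflect h q o p)
reflect-mid [] = []
reflect-mid {h} {x ∷ q} {z ∷ o} {y ∷ p} ((l , u) ∷ m) =
  (≤-trans (≤-reflexive (sym (m+n∸n≡m _ (x ⊓ h)))) (∸-monoʳ-≤ (z ⊔ hd q + x ⊓ h) u) ,
   ≤-trans (∸-monoʳ-≤ (z ⊔ hd q + x ⊓ h) l) (≤-reflexive (m+n∸m≡n (z ⊔ hd q) (x ⊓ h)))) ∷ reflect-mid m

reflect-involutive : ∀ {h q o p} → Mid h q o p → reflect h q o (reflect h q o p) ≡ p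
reflect-involutive [] = refl
reflect-involutive {h} {x ∷ q} {z ∷ o} ((l , u) ∷ m) =
  cong₂ _∷_ (m∸[m∸n]≡n (≤-trans u (m≤n+m (x ⊓ h) (z ⊔ hd q)))) (reflect-involutive m)

-- An entry and its reflection add up to the two ends of their interval. The lower end z ⊔ w of one
-- interval and the upper end w ⊓ z of the next add up to z + w, so the total telescopes to the
-- entries of `q` and `o`; only the topmost end involves `h`. The summand `hd q` on the left avoids
-- a subtraction.
reflect-sum : ∀ {h q o p} → Mid h q o p →
  sum p + sum (reflect h q o p) + hd q ≡ hd q ⊓ h + (sum q + sum o)
reflect-sum [] = refl
reflect-sum {h} {x ∷ q} {z ∷ o} {y ∷ p} ((l , u) ∷ m) = begin
  y + sum p + (y′ + sum r) + x          ≡⟨ shuffle₁ y (sum p) y′ (sum r) x ⟩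
  y + y′ + (sum p + sum r + x)          ≡⟨ cong (_+ (sum p + sum r + x))
    (m+[n∸m]≡n (≤-trans u (m≤n+m _ _))) ⟩
  z ⊔ w + x ⊓ h + (sum p + sum r + x)   ≡⟨ shuffle₂ (z ⊔ w) (x ⊓ h) (sum p + sum r) x ⟩
  x ⊓ h + (x + (z ⊔ w + (sum p + sum r))) ≡⟨ cong (λ t → x ⊓ h + (x + t)) lemma ⟩
  x ⊓ h + (x + (z + (sum q + sum o)))   ≡⟨ shuffle₃ (x ⊓ h) x z (sum q) (sum o) ⟩
  x ⊓ h + (x + sum q + (z + sum o))     ∎
  where
    open ≡-Reasoning
    w = hd q
    r = reflect z q o p
    y′ = z ⊔ w + x ⊓ h ∸ y
    shuffle₁ : ∀ a b c d e → a + b + (c + d) + e ≡ a + c + (b + d + e)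
    shuffle₁ = solve-∀
    shuffle₂ : ∀ a b c d → a + b + (c + d) ≡ b + (d + (a + c))
    shuffle₂ = solve-∀
    shuffle₃ : ∀ a b c d e → a + (b + (c + (d + e))) ≡ a + (b + d + (c + e))
    shuffle₃ = solve-∀
    m⊔n+m⊓n : ∀ a b → a ⊔ b + b ⊓ a ≡ a + b
    m⊔n+m⊓n a b with ≤-total a b
    ... | inj₁ a≤b = trans (cong₂ _+_ (m≤n⇒m⊔n≡n a≤b) (m≥n⇒m⊓n≡n a≤b)) (+-comm b a)
    ... | inj₂ b≤a = cong₂ _+_ (m≥n⇒m⊔n≡m b≤a) (m≤n⇒m⊓n≡m b≤a)
    lemma : z ⊔ w + (sum p + sum r) ≡ z + (sum q + sum o)
    lemma = +-cancelʳ-≡ w _ _ (begin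
      z ⊔ w + (sum p + sum r) + w        ≡⟨ +-assoc (z ⊔ w) _ w ⟩
      z ⊔ w + (sum p + sum r + w)        ≡⟨ cong (z ⊔ w +_) (reflect-sum m) ⟩
      z ⊔ w + (w ⊓ z + (sum q + sum o))  ≡⟨ +-assoc (z ⊔ w) (w ⊓ z) _ ⟨
      z ⊔ w + w ⊓ z + (sum q + sum o)    ≡⟨ cong (_+ (sum q + sum o)) (m⊔n+m⊓n z w) ⟩
      z + w + (sum q + sum o)            ≡⟨ solve-+ z w (sum q + sum o) ⟩
      z + (sum q + sum o) + w            ∎)
      where
        solve-+ : ∀ a b c → a + b + c ≡ a + c + b
        solve-+ = solve-∀

-- The bound `hd q` on the first entry already follows from `Strip p q`, and with this choice of `h`
-- the boundary terms cancel.
reflect-sum′ : ∀ {q o p} → Mid (hd q) q o p → sum p + sum (reflect (hd q) q o p) ≡ sum q + sum o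
reflect-sum′ {q} {o} {p} m = +-cancelʳ-≡ (hd q) _ _
  (trans (reflect-sum m) (trans (cong (_+ (sum q + sum o)) (⊓-idem (hd q))) (+-comm (hd q) _)))

strip-hd : ∀ {p q} → Strip p q → hd p ≤ hd q
strip-hd [] = z≤n
strip-hd ((_ , u) ∷ _) = u

reflectChain : List ℕ → List (List ℕ) → List (List ℕ)
reflectChain q (p ∷ o ∷ ks) = reflect (hd q) q o p ∷ o ∷ ks
reflectChain q ks = ks

-- The shape `p` and its reflection r satisfy sum p + sum r = sum q + sum o, so the sizes of the two
-- strips between `o` and `q` are exchanged. The chain below `o` stays the same.
reflectChain-chain : ∀ {q a b α ks} → Chain q (a ∷ b ∷ α) ks → Chain q (b ∷ a ∷ α) (reflectChain q ks)
reflectChain-chain {q} {a} {b} (step {p} s e (step {o} s′ e′ c)) =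
  step (proj₁ (mid⁻ m′)) eq₁ (step (proj₁ (proj₂ (mid⁻ m′))) eq₂ c)
  where
    m = mid s s′ (strip-hd s)
    m′ = reflect-mid m
    r = reflect (hd q) q o p
    shuffle : ∀ o b r → o + b + r ≡ r + b + o
    shuffle = solve-∀
    eq₁ : sum r + b ≡ sum q
    eq₁ = +-cancelʳ-≡ (sum o) _ _
      (trans (trans (sym (shuffle (sum o) b (sum r))) (cong (_+ sum r) e′)) (reflect-sum′ m))
    eq₂ : sum o + a ≡ sum r
    eq₂ = +-cancelʳ-≡ (sum p) _ _ (begin
      sum o + a + sum p   ≡⟨ shuffle (sum o) a (sum p) ⟩
      sum p + a + sum o   ≡⟨ cong (_+ sum o) e ⟩
      sum q + sum o       ≡⟨ reflect-sum′ m ⟨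
      sum p + sum r       ≡⟨ +-comm (sum p) (sum r) ⟩
      sum r + sum p       ∎)
      where open ≡-Reasoning

reflectChain-involutive : ∀ {q a b α ks} → Chain q (a ∷ b ∷ α) ks → reflectChain q (reflectChain q ks)
  ≡ ks
reflectChain-involutive (step s e (step {o} s′ e′ c)) =
  cong (λ p → p ∷ o ∷ _) (reflect-involutive (mid s s′ (strip-hd s)))

K-swap-≤ : ∀ q a b α → K q (a ∷ b ∷ α) ≤ K q (b ∷ a ∷ α)
K-swap-≤ q a b α = length-≤ (λ ks ks′ → ks′ ≡ reflectChain q ks)
  (All.map (λ c → lose (∈-chains⁺ (reflectChain-chain c)) refl) (chains-All q (a ∷ b ∷ α)))
  (AllPairs-with
    (λ c c′ ≢ _ e e′ → ≢ (trans (sym (reflectChain-involutive c))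
      (trans (cong (reflectChain q) (trans (sym e) e′)) (reflectChain-involutive c′))))
    (chains-All q (a ∷ b ∷ α)) (chains-unique q (a ∷ b ∷ α)))

K-∷ : ∀ q a α → K q (a ∷ α) ≡ sum (map (λ p → K p α) (removals q a))
K-∷ q a α = go (removals q a)
  where
    go : ∀ ps → length (concatMap (λ p → map (p ∷_) (chains p α)) ps) ≡ sum (map (λ p → K p α) ps)
    go [] = refl
    go (p ∷ ps) = trans (length-++ (map (p ∷_) (chains p α)))
      (cong₂ _+_ (length-map (p ∷_) (chains p α)) (go ps))

K-cong-∷ : ∀ α β → (∀ q → K q α ≡ K q β) → ∀ q a → K q (a ∷ α) ≡ K q (a ∷ β)
K-cong-∷ α β h q a = trans (K-∷ q a α)
  (trans (cong sum (map-cong h (removals q a))) (sym (K-∷ q a β)))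

-- `K-swap-≤` exchanges only the two largest letters; a transposition further down is reached by
-- expanding along the letters above it with `K-∷`.
K-↭ : ∀ {α β} → α ↭ β → ∀ q → K q α ≡ K q β
K-↭ Perm.refl q = refl
K-↭ (Perm.prep {α} {β} a p) q = K-cong-∷ α β (K-↭ p) q a
K-↭ (Perm.swap {α} {β} a b p) q = trans (≤-antisym (K-swap-≤ q a b α) (K-swap-≤ q b a α))
  (K-cong-∷ (a ∷ α) (a ∷ β) (λ q → K-cong-∷ α β (K-↭ p) q a) q b)
K-↭ (Perm.trans p p′) q = trans (K-↭ p q) (K-↭ p′ q)

-- The intervals do not depend on the entries of `p`, so one entry can be raised while the others
-- stay. It is raised at the first place where `p` is smaller than `p′`; a place with y ≥ y′ passes
-- the strict inequality of sums on to the tails.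
increment : ∀ {h q o p p′} → Mid h q o p → Mid h q o p′ → sum p < sum p′ →
  ∃ λ p″ → Mid h q o p″ × sum p″ ≡ suc (sum p)
increment {p = y ∷ p} {y′ ∷ p′} ((l , u) ∷ m) ((l′ , u′) ∷ m′) lt with y <? y′
... | yes y<y′ = suc y ∷ p , (m≤n⇒m≤1+n l , ≤-trans y<y′ u′) ∷ m , refl
... | no y≮y′ with p″ , m″ , e ← increment m m′
        (+-cancelˡ-< y′ _ _ (≤-<-trans (+-monoˡ-≤ (sum p) (≮⇒≥ y≮y′)) lt))
  = y ∷ p″ , (l , u) ∷ m″ , trans (cong (y +_) e) (+-suc y (sum p))

-- The reflection of `p` leaves a strip of only b cells below `q`, whereas `p` leaves a + 1, so the
-- reflection has the larger sum. Hence `increment` applies and adds one cell to `p`, which takes a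
-- cell from the first strip and gives it to the second.
K-balance : ∀ {q a b α} → b < a → 0 < K q (suc a ∷ b ∷ α) → 0 < K q (a ∷ suc b ∷ α)
K-balance {q} {a} {b} {α} b<a h with K-pos⁻ q (suc a ∷ b ∷ α) h
... | .(p ∷ o ∷ _) , c@(step {p} s e (step {o} s′ e′ c′))
  with step _ e₁ (step _ e₂ _) ← reflectChain-chain c
  with p″ , m″ , e″ ← increment (mid s s′ (strip-hd s)) (reflect-mid (mid s s′ (strip-hd s)))
         (+-cancelʳ-< b _ _ (subst (_< sum (reflect (hd q) q o p) + b) (+-comm b _)
            (subst (b + sum p <_) (trans e (sym e₁))
              (subst (_< sum p + suc a) (+-comm (sum p) b) (+-monoʳ-< (sum p) (m<n⇒m<1+n b<a))))))
  = K-pos (step (proj₁ (mid⁻ m″)) (trans (cong (_+ a) e″) (trans (sym (+-suc (sum p) a)) e))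
      (step (proj₁ (proj₂ (mid⁻ m″))) (trans (+-suc (sum o) b) (trans (cong suc e′) (sym e″))) c′))

-- Tableaux as chains of shapes

at : List ℕ → ℕ → ℕ
at [] _ = 0
at (x ∷ xs) zero = x
at (x ∷ xs) (suc i) = at xs i

at-outside : ∀ xs {i} → length xs ≤ i → at xs i ≡ 0
at-outside [] _ = refl
at-outside (x ∷ xs) (s≤s l) = at-outside xs l

at-tabulate : ∀ {k} (f : Fin k → ℕ) i → at (tabulate f) (toℕ i) ≡ f i
at-tabulate f zero = refl
at-tabulate f (suc i) = at-tabulate (f ∘ suc) i

applyUpTo-at : ∀ xs → applyUpTo (at xs) (length xs) ≡ xs
applyUpTo-at [] = refl
applyUpTo-at (x ∷ xs) = cong (x ∷_) (applyUpTo-at xs)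

applyDownFrom-at : ∀ xs → applyDownFrom (at xs) (length xs) ↭ xs
applyDownFrom-at xs = ↭-trans (↭-reflexive (sym (reverse-applyUpTo (at xs) (length xs))))
  (↭-trans (↭-reverse _) (↭-reflexive (applyUpTo-at xs)))

applyDownFrom-cong : ∀ {A : Set} {f g : ℕ → A} n → (∀ {j} → j < n → f j ≡ g j) →
  applyDownFrom f n ≡ applyDownFrom g n
applyDownFrom-cong zero h = refl
applyDownFrom-cong (suc n) h = cong₂ _∷_ (h ≤-refl) (applyDownFrom-cong n (λ l → h (m<n⇒m<1+n l)))

applyDownFrom-injective : ∀ {A : Set} {f g : ℕ → A} n → applyDownFrom f n ≡ applyDownFrom g n →
  ∀ {j} → j < n → f j ≡ g j
applyDownFrom-injective (suc n) e {j} (s≤s j≤n) with m≤n⇒m<n∨m≡n j≤n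
... | inj₁ j<n = applyDownFrom-injective n (proj₂ (∷-injective e)) j<n
... | inj₂ refl = proj₁ (∷-injective e)

tabulate-injective : ∀ {A : Set} {k} (f g : Fin k → A) → tabulate f ≡ tabulate g → ∀ i → f i ≡ g i
tabulate-injective f g e zero = proj₁ (∷-injective e)
tabulate-injective f g e (suc i) = tabulate-injective (f ∘ suc) (g ∘ suc) (proj₂ (∷-injective e)) i

clamp : ∀ {N} → ℕ → Fin (suc N)
clamp {N} x with x <? suc N
... | yes p = fromℕ< p
... | no _ = zero

toℕ-clamp : ∀ {N x} → x < suc N → toℕ (clamp {N} x) ≡ x
toℕ-clamp {N} {x} l with x <? suc N
... | yes p = toℕ-fromℕ< p
... | no ¬p = ⊥-elim (¬p l)

strip-tabulate : ∀ {k} {f g : Fin k → ℕ} → (∀ r → f r ≤ g r) →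
  (∀ r r′ → toℕ r′ ≡ suc (toℕ r) → g r′ ≤ f r) → Strip (tabulate f) (tabulate g)
strip-tabulate {zero} _ _ = []
strip-tabulate {suc zero} h _ = (z≤n , h zero) ∷ []
strip-tabulate {suc (suc k)} h h′ = (h′ zero (suc zero) refl , h zero) ∷
  strip-tabulate (h ∘ suc) (λ r r′ e → h′ (suc r) (suc r′) (cong suc e))

record SSYT {N} (μ : Fin (suc N) → ℕ) (T : Fin (suc N) → Fin (suc N) → Fin (suc N)) : Set where
  field
    outside : ∀ r c → ¬ toℕ c < μ r → T r c ≡ zero
    row : ∀ r {c c′} → toℕ c < toℕ c′ → toℕ c′ < μ r → toℕ (T r c) ≤ toℕ (T r c′)
    col : ∀ {r r′} c → toℕ r < toℕ r′ → toℕ c < μ r′ → toℕ (T r c) < toℕ (T r′ c)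

content : ∀ {N} (μ : Fin N → ℕ) → (Fin N → Fin N → Fin N) → ℕ → ℕ
content μ T j = ∑ (λ r → # (λ c → inShape μ r c ∧ (toℕ (T r c) ≡ᵇ j)))

private
  module _ {N} (μ : Fin (suc N) → ℕ) (T : Fin (suc N) → Fin (suc N) → Fin (suc N)) where
    outsideᵇ rowsᵇ colsᵇ : Bool
    outsideAt : (r c : Fin (suc N)) → Bool
    rowAt colAt : (r c c′ : Fin (suc N)) → Bool
    outsideAt r c = inShape μ r c ∨ eqF (T r c) zero
    rowAt r c c′ = not (ltF c c′ ∧ inShape μ r c′) ∨ leF (T r c) (T r c′)
    colAt r r′ c = not (ltF r r′ ∧ inShape μ r′ c) ∨ ltF (T r c) (T r′ c)
    outsideᵇ = allB λ r → allB (outsideAt r)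
    rowsᵇ = allB λ r → allB λ c → allB (rowAt r c)
    colsᵇ = allB λ r → allB λ r′ → allB (colAt r r′)

isSSYT-true : ∀ {N} {μ : Fin (suc N) → ℕ} {T} → isSSYT μ T ≡ true → SSYT μ T
isSSYT-true {μ = μ} {T} e = record
  { outside = λ r c c≮ → dec-true (T r c ≟F zero)
      (∨-trueʳ (allB⁻ (outsideAt μ T r) (allB⁻ (λ r → allB (outsideAt μ T r)) e₁ r) c)
        (λ t → c≮ (<ᵇ-true t)))
  ; row = λ r {c} {c′} l s → dec-true (T r c ≤F? T r c′)
      (⇒-true {ltF c c′ ∧ inShape μ r c′}
        (allB⁻ (rowAt μ T r c)
          (allB⁻ (λ c → allB (rowAt μ T r c))
          (allB⁻ (λ r → allB λ c → allB (rowAt μ T r c)) e₂ r) c) c′)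
        (∧-true⁻ (dec-true⁻ (c <F? c′) l) (<ᵇ-true⁻ s)))
  ; col = λ {r} {r′} c l s → dec-true (T r c <F? T r′ c)
      (⇒-true {ltF r r′ ∧ inShape μ r′ c}
        (allB⁻ (colAt μ T r r′)
          (allB⁻ (λ r′ → allB (colAt μ T r r′))
          (allB⁻ (λ r → allB λ r′ → allB (colAt μ T r r′)) e₃ r) r′) c)
        (∧-true⁻ (dec-true⁻ (r <F? r′) l) (<ᵇ-true⁻ s)))
  }
  where
    e₁ = proj₁ (∧-true {outsideᵇ μ T} {rowsᵇ μ T ∧ colsᵇ μ T} e)
    e₂ = proj₁ (∧-true {rowsᵇ μ T} {colsᵇ μ T} (proj₂ (∧-true {outsideᵇ μ T} e)))
    e₃ = proj₂ (∧-true {rowsᵇ μ T} {colsᵇ μ T} (proj₂ (∧-true {outsideᵇ μ T} e)))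
    ∨-trueʳ : ∀ {a b} → a ∨ b ≡ true → ¬ a ≡ true → b ≡ true
    ∨-trueʳ {true} _ ¬a = ⊥-elim (¬a refl)
    ∨-trueʳ {false} e _ = e

isSSYT-true⁻ : ∀ {N} {μ : Fin (suc N) → ℕ} {T} → SSYT μ T → isSSYT μ T ≡ true
isSSYT-true⁻ {μ = μ} {T} s = ∧-true⁻ {outsideᵇ μ T}
  (allB⁺ _ λ r → allB⁺ (outsideAt μ T r) λ c → outside′ r c)
  (∧-true⁻ {rowsᵇ μ T}
    (allB⁺ _ λ r → allB⁺ _ λ c → allB⁺ (rowAt μ T r c) λ c′ → ⇒-true⁻ {ltF c c′ ∧ inShape μ r c′} λ e →
      dec-true⁻ (T r c ≤F? T r c′)
        (row r (dec-true (c <F? c′) (proj₁ (∧-true e))) (<ᵇ-true (proj₂ (∧-true {ltF c c′} e)))))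
    (allB⁺ _ λ r → allB⁺ _ λ r′ → allB⁺ (colAt μ T r r′) λ c → ⇒-true⁻ {ltF r r′ ∧ inShape μ r′ c} λ e →
      dec-true⁻ (T r c <F? T r′ c)
        (col c (dec-true (r <F? r′) (proj₁ (∧-true e))) (<ᵇ-true (proj₂ (∧-true {ltF r r′} e))))))
  where
    open SSYT s
    outside′ : ∀ r c → inShape μ r c ∨ eqF (T r c) zero ≡ true
    outside′ r c with toℕ c <ᵇ μ r in e
    ... | true = refl
    ... | false = dec-true⁻ (T r c ≟F zero)
      (outside r c (λ l → false≢true (trans (sym e) (<ᵇ-true⁻ l))))

eqF-≡ᵇ : ∀ {k} (i j : Fin k) → eqF i j ≡ (toℕ i ≡ᵇ toℕ j)
eqF-≡ᵇ i j = ⇔→≡ (λ e → ≡ᵇ-true⁻ (cong toℕ (dec-true (i ≟F j) e)))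
  (λ e → dec-true⁻ (i ≟F j) (toℕ-injective (≡ᵇ-true e)))

tabContent-sum : ∀ {N} (μ : Fin N → ℕ) T i →
  sum (map (λ r → countL (λ c → inShape μ r c ∧ eqF (T r c) i) (allFin N)) (allFin N)) ≡ content μ T
    (toℕ i)
tabContent-sum {N} μ T i = trans (sum-allFin {N} count)
  (∑-cong λ r → trans (countL-# (λ c → inShape μ r c ∧ eqF (T r c) i))
    (#-cong λ c → cong (inShape μ r c ∧_) (eqF-≡ᵇ (T r c) i)))
  where
    count : Fin N → ℕ
    count r = countL (λ c → inShape μ r c ∧ eqF (T r c) i) (allFin N)

tabContent-true : ∀ {N} {μ : Fin N → ℕ} {T α} → tabContent μ T α ≡ true → ∀ i → content μ T (toℕ i)
  ≡ α i
tabContent-true {μ = μ} {T} e i = trans (sym (tabContent-sum μ T i)) (≡ᵇ-true (allB⁻ _ e i))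

tabContent-true⁻ : ∀ {N} {μ : Fin N → ℕ} {T α} → (∀ i → content μ T (toℕ i) ≡ α i) → tabContent μ T α
  ≡ true
tabContent-true⁻ {μ = μ} {T} h = allB⁺ _ λ i → ≡ᵇ-true⁻ (trans (tabContent-sum μ T i) (h i))

module _ {N : ℕ} (μ : Fin (suc N) → ℕ) where

  private
    M = suc N
    Filling = Fin M → Fin M → Fin M

  -- The r-th row of the subtableau of T with entries below j has length level T j r.
  level : Filling → ℕ → Fin M → ℕ
  level T j r = # (λ c → inShape μ r c ∧ (toℕ (T r c) <ᵇ j))

  below⁺ : ∀ (T : Filling) j r c → toℕ c < μ r → toℕ (T r c) < j → inShape μ r c ∧ (toℕ (T r c) <ᵇ j)
    ≡ true
  below⁺ T j r c l l′ = ∧-true⁻ (<ᵇ-true⁻ l) (<ᵇ-true⁻ l′)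

  below⁻ : ∀ (T : Filling) j r c → inShape μ r c ∧ (toℕ (T r c) <ᵇ j) ≡ true → toℕ c < μ r × toℕ (T r c)
    < j
  below⁻ T j r c e with e₁ , e₂ ← ∧-true {inShape μ r c} e = <ᵇ-true e₁ , <ᵇ-true e₂

  shape : Filling → ℕ → List ℕ
  shape T j = tabulate (level T j)

  𝟙-<ᵇ-suc : ∀ s t j → 𝟙 (s ∧ (t <ᵇ suc j)) ≡ 𝟙 (s ∧ (t <ᵇ j)) + 𝟙 (s ∧ (t ≡ᵇ j))
  𝟙-<ᵇ-suc false t j = refl
  𝟙-<ᵇ-suc true zero zero = refl
  𝟙-<ᵇ-suc true zero (suc j) = refl
  𝟙-<ᵇ-suc true (suc t) zero = refl
  𝟙-<ᵇ-suc true (suc t) (suc j) = 𝟙-<ᵇ-suc true t j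

  shape-content : ∀ T j → sum (shape T j) + content μ T j ≡ sum (shape T (suc j))
  shape-content T j = begin
    sum (shape T j) + content μ T j   ≡⟨ cong (_+ content μ T j) (∑-def (level T j)) ⟨
    ∑ (level T j) + content μ T j     ≡⟨ ∑-+ (level T j) _ ⟨
    ∑ (λ r → level T j r + # (λ c → inShape μ r c ∧ (toℕ (T r c) ≡ᵇ j)))
      ≡⟨ ∑-cong (λ r → sym (#-+ (λ c → 𝟙-<ᵇ-suc (inShape μ r c) (toℕ (T r c)) j))) ⟩
    ∑ (level T (suc j))               ≡⟨ ∑-def (level T (suc j)) ⟩
    sum (shape T (suc j))             ∎
    where open ≡-Reasoning

  module _ (antitone : ∀ {r r′} → toℕ r < toℕ r′ → μ r′ ≤ μ r) (bounded : ∀ r → μ r ≤ M) where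

    shape-M : ∀ T → shape T M ≡ tabulate μ
    shape-M T = tabulate-cong λ r → trans
      (#-cong (λ c → ⇔→≡ (λ e → proj₁ (∧-true e)) (λ e → ∧-true⁻ e (<ᵇ-true⁻ (toℕ<n (T r c))))))
      (#-<ᵇ (μ r) (bounded r))

    level-step : ∀ T j r → level T j r ≤ level T (suc j) r
    level-step T j r = #-mono λ c e → let l , l′ = below⁻ T j r c e in below⁺ T (suc j) r c l (m<n⇒m<1+n l′)

    -- Column strictness becomes the interlacing condition of a horizontal strip: directly above an
    -- entry at most `j` stands an entry less than `j`.
    level-next : ∀ {T} → SSYT μ T → ∀ j r r′ → toℕ r′ ≡ suc (toℕ r) → level T (suc j) r′ ≤ level T j r
    level-next {T} s j r r′ e = #-mono λ c t →
      let l , l′ = below⁻ T (suc j) r′ c t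
          r<r′ = ≤-reflexive (sym e)
      in below⁺ T j r c (<-≤-trans l (antitone r<r′)) (<-≤-trans (SSYT.col s c r<r′ l) (s≤s⁻¹ l′))

    level-zero : ∀ T r → level T 0 r ≡ 0
    level-zero T r = #-false λ c e → n≮0 (proj₂ (below⁻ T 0 r c e))

    chain-of : ∀ {T} → SSYT μ T → ∀ j → Chain (shape T j) (applyDownFrom (content μ T) j)
      (applyDownFrom (shape T) j)
    chain-of {T} s zero = done (All.tabulate⁺ (level-zero T))
    chain-of {T} s (suc j) =
      step (strip-tabulate (level-step T j) (level-next s j)) (shape-content T j) (chain-of s j)

    -- Rows increase weakly, so the cells of row `r` with entries less than `j` form an initial
    -- segment, whose length is the level.
    level-< : ∀ {T} → SSYT μ T → ∀ r c j → toℕ c < μ r →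
      (toℕ (T r c) < j → toℕ c < level T j r) × (toℕ c < level T j r → toℕ (T r c) < j)
    level-< {T} s r c j c<μ = (λ l → proj₁ initial (below⁺ T j r c c<μ l)) ,
      (λ l → proj₂ (below⁻ T j r c (proj₂ initial l)))
      where
        down : ∀ {i k} → toℕ i ≤ toℕ k → inShape μ r k ∧ (toℕ (T r k) <ᵇ j) ≡ true →
          inShape μ r i ∧ (toℕ (T r i) <ᵇ j) ≡ true
        down {i} {k} i≤k e with m≤n⇒m<n∨m≡n i≤k | below⁻ T j r k e
        ... | inj₂ i≡k | _ rewrite toℕ-injective i≡k = e
        ... | inj₁ i<k | l , l′ = below⁺ T j r i (<-trans i<k l) (≤-<-trans (SSYT.row s r i<k l) l′)
        initial = #-initial (λ c → inShape μ r c ∧ (toℕ (T r c) <ᵇ j)) (λ {i} {k} → down {i} {k}) c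

    -- If two entries of the same cell differ, let j be the larger one. By `level-<` the column
    -- index is smaller than the level at j of one tableau but not of the other. Since j < M, the
    -- shape at j is among those recorded.
    shape-injective : ∀ {T T′} → SSYT μ T → SSYT μ T′ → applyDownFrom (shape T) M ≡ applyDownFrom
      (shape T′) M →
      ∀ r c → T r c ≡ T′ r c
    shape-injective {T} {T′} s s′ e r c with toℕ c <? μ r
    ... | no c≮μ = trans (SSYT.outside s r c c≮μ) (sym (SSYT.outside s′ r c c≮μ))
    ... | yes c<μ with <-cmp (toℕ (T r c)) (toℕ (T′ r c))
    ... | tri≈ _ t≡ _ = toℕ-injective t≡
    ... | tri< t< _ _ = ⊥-elim (<-irrefl refl (proj₂ (level-< s′ r c j c<μ)
          (subst (toℕ c <_) (level-≡ (toℕ<n (T′ r c))) (proj₁ (level-< s r c j c<μ) t<))))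
      where
        j = toℕ (T′ r c)
        level-≡ : j < M → level T j r ≡ level T′ j r
        level-≡ l = tabulate-injective (level T j) (level T′ j) (applyDownFrom-injective M e l) r
    ... | tri> _ _ t> = ⊥-elim (<-irrefl refl (proj₂ (level-< s r c j c<μ)
          (subst (toℕ c <_) (level-≡ (toℕ<n (T r c))) (proj₁ (level-< s′ r c j c<μ) t>))))
      where
        j = toℕ (T r c)
        level-≡ : j < M → level T′ j r ≡ level T j r
        level-≡ l = tabulate-injective (level T′ j) (level T j) (sym (applyDownFrom-injective M e l)) r

-- The entry in row r and column c of the tableau recorded by a chain.
entry : List (List ℕ) → ℕ → ℕ → ℕ
entry [] r c = 0
entry (p ∷ ks) r c = if c <ᵇ at p r then entry ks r c else length ks

strip-≤ : ∀ {p q} → Strip p q → ∀ r → at p r ≤ at q r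
strip-≤ [] r = z≤n
strip-≤ ((_ , u) ∷ s) zero = u
strip-≤ (_ ∷ s) (suc r) = strip-≤ s r

hd-at : ∀ q → hd q ≡ at q 0
hd-at [] = refl
hd-at (_ ∷ _) = refl

strip-≥ : ∀ {p q} → Strip p q → ∀ {r r′} → r < r′ → at q r′ ≤ at p r
strip-≥ [] _ = z≤n
strip-≥ {q = x ∷ q} ((l , _) ∷ s) {zero} {suc zero} _ = ≤-trans (≤-reflexive (sym (hd-at q))) l
strip-≥ {q = x ∷ q} (lu ∷ s) {zero} {suc (suc r′)} _ = ≤-trans (strip-≥ s {zero} {suc r′} (s≤s z≤n))
  (≤-trans (strip-≤ s zero) (≤-trans (≤-reflexive (sym (hd-at q))) (proj₁ lu)))
strip-≥ (_ ∷ s) {suc r} {suc r′} (s≤s l) = strip-≥ s l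

at-zero : ∀ {q} → All (_≡ 0) q → ∀ r → at q r ≡ 0
at-zero [] r = refl
at-zero (z ∷ _) zero = z
at-zero (_ ∷ zs) (suc r) = at-zero zs r

entry-cons : ∀ (P : ℕ → Set) p ks r c → (c < at p r → P (entry ks r c)) →
  (¬ c < at p r → P (length ks)) →
  P (entry (p ∷ ks) r c)
entry-cons P p ks r c f g with c <ᵇ at p r in e
... | true = f (<ᵇ-true e)
... | false = g (λ l → false≢true (trans (sym e) (<ᵇ-true⁻ l)))

entry-in : ∀ p ks r c → c < at p r → entry (p ∷ ks) r c ≡ entry ks r c
entry-in p ks r c l rewrite <ᵇ-true⁻ l = refl

entry-< : ∀ {q α ks} → Chain q α ks → ∀ {r c} → c < at q r → entry ks r c < length ks
entry-< (done z) {r} {c} l = ⊥-elim (n≮0 (subst (c <_) (at-zero z r) l))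
entry-< (step {p} {ks = ks} s e ch) _ =
  entry-cons (λ t → t < suc (length ks)) p ks _ _ (λ l → m<n⇒m<1+n (entry-< ch l)) (λ _ → ≤-refl)

entry-row : ∀ {q α ks} → Chain q α ks → ∀ {r c c′} → c < c′ → c′ < at q r → entry ks r c ≤ entry ks r c′
entry-row (done z) l l′ = z≤n
entry-row (step {p} {ks = ks} s e ch) {r} {c} {c′} l l′ =
  entry-cons (λ t → entry (p ∷ ks) r c ≤ t) p ks r c′
    (λ l″ → subst (_≤ entry ks r c′) (sym (entry-in p ks r c (<-trans l l″))) (entry-row ch l l″))
    (λ _ → entry-cons (λ t → t ≤ length ks) p ks r c (λ l → <⇒≤ (entry-< ch l)) (λ _ → ≤-refl))

entry-col : ∀ {q α ks} → Chain q α ks → ∀ {r r′ c} → r < r′ → c < at q r′ → entry ks r c < entry ks r′ c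
entry-col (done z) {r′ = r′} {c} l l′ = ⊥-elim (n≮0 (subst (c <_) (at-zero z r′) l′))
entry-col (step {p} {ks = ks} s e ch) {r} {r′} {c} l l′ =
  subst (_< entry (p ∷ ks) r′ c) (sym (entry-in p ks r c c<p))
    (entry-cons (λ t → entry ks r c < t) p ks r′ c (entry-col ch l) (λ _ → entry-< ch c<p))
  where
    c<p : c < at p r
    c<p = <-≤-trans l′ (strip-≥ s l)

strip-length : ∀ {p q} → Strip p q → length p ≡ length q
strip-length [] = refl
strip-length (_ ∷ s) = cong suc (strip-length s)

tabulate-at : ∀ k (q : List ℕ) → length q ≡ k → tabulate {n = k} (λ r → at q (toℕ r)) ≡ q
tabulate-at zero [] _ = refl
tabulate-at (suc k) (x ∷ q) e = cong (x ∷_) (tabulate-at k q (suc-injective e))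

-- The chain can be read off the tableau it defines. The letter removed first is `length ks`, so the
-- cells with smaller entries are those of `p`. For smaller j no cell outside `p` is counted, and
-- the claim reduces to the rest of the chain.
entry-levels : ∀ {M q α ks} → Chain q α ks → length q ≡ M → (∀ r → at q r ≤ M) →
  applyDownFrom (λ j → tabulate {n = M}
    (λ r → # {M} (λ c → (toℕ c <ᵇ at q (toℕ r)) ∧ (entry ks (toℕ r) (toℕ c) <ᵇ j))))
    (length ks) ≡ ks
entry-levels (done z) _ _ = refl
entry-levels {M} {q} (step {p} {ks = ks} s e ch) len b = cong₂ _∷_ top
  (trans (applyDownFrom-cong (length ks) λ {j} j< → tabulate-cong λ r → #-cong λ c → lower j< r c)
    (entry-levels ch (trans (strip-length s) len) (λ r → ≤-trans (strip-≤ s r) (b r))))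
  where
    top : tabulate {n = M}
      (λ r → # {M} (λ c → (toℕ c <ᵇ at q (toℕ r)) ∧ (entry (p ∷ ks) (toℕ r) (toℕ c) <ᵇ length ks))) ≡ p
    top = trans (tabulate-cong λ r → trans
        (#-cong λ c → ⇔→≡
          (λ t → <ᵇ-true⁻ (entry-cons (λ x → x < length ks → toℕ c < at p (toℕ r)) p ks (toℕ r) (toℕ c)
            (λ l _ → l) (λ _ l → ⊥-elim (<-irrefl refl l))
             (<ᵇ-true (proj₂ (∧-true {toℕ c <ᵇ at q (toℕ r)} t)))))
          (λ t → let l = <ᵇ-true t in ∧-true⁻ (<ᵇ-true⁻ (<-≤-trans l (strip-≤ s (toℕ r))))
             (<ᵇ-true⁻ (subst (_< length ks) (sym (entry-in p ks (toℕ r) (toℕ c) l)) (entry-< ch l)))))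
        (#-<ᵇ (at p (toℕ r)) (≤-trans (strip-≤ s (toℕ r)) (b (toℕ r)))))
      (tabulate-at M p (trans (strip-length s) len))
    lower : ∀ {j} → j < length ks → ∀ (r c : Fin M) →
      ((toℕ c <ᵇ at q (toℕ r)) ∧ (entry (p ∷ ks) (toℕ r) (toℕ c) <ᵇ j)) ≡
        ((toℕ c <ᵇ at p (toℕ r)) ∧ (entry ks (toℕ r) (toℕ c) <ᵇ j))
    lower {j} j< r c = ⇔→≡
      (λ t → entry-cons (λ x → x < j → (toℕ c <ᵇ at p (toℕ r)) ∧ (entry ks (toℕ r) (toℕ c) <ᵇ j)
        ≡ true) p ks (toℕ r) (toℕ c)
         (λ l l′ → ∧-true⁻ (<ᵇ-true⁻ l) (<ᵇ-true⁻ l′)) (λ _ l → ⊥-elim (<-asym l j<))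
           (<ᵇ-true (proj₂ (∧-true {toℕ c <ᵇ at q (toℕ r)} t))))
      (λ t → let l = <ᵇ-true (proj₁ (∧-true t)) in ∧-true⁻ (<ᵇ-true⁻ (<-≤-trans l (strip-≤ s (toℕ r))))
         (subst (λ x → (x <ᵇ j) ≡ true) (sym (entry-in p ks (toℕ r) (toℕ c) l)) (proj₂ (∧-true t))))

chain-contents : ∀ {a : ℕ → ℕ} {k : ℕ → List ℕ} n → Chain (k n) (applyDownFrom a n)
  (applyDownFrom k n) →
  ∀ {j} → j < n → sum (k j) + a j ≡ sum (k (suc j))
chain-contents (suc n) (step s e ch) {j} (s≤s j≤n) with m≤n⇒m<n∨m≡n j≤n
... | inj₁ j<n = chain-contents n ch j<n
... | inj₂ refl = e

chain-length : ∀ {q α ks} → Chain q α ks → length ks ≡ length α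
chain-length (done _) = refl
chain-length (step _ _ ch) = cong suc (chain-length ch)

-- Kostka numbers counted by tableaux and by chains

module _ {N : ℕ} (μ : Fin (suc N) → ℕ) (antitone : ∀ {r r′} → toℕ r < toℕ r′ → μ r′ ≤ μ r)
  (bounded : ∀ r → μ r ≤ suc N)
         (α : Fin (suc N) → ℕ) where

  private
    M = suc N
    Filling = Fin M → Fin M → Fin M
    -- Chains delete the largest letter first, so the multiplicities appear in reverse; `kostka≡K`
    -- undoes this by the symmetry of `K`.
    αs = applyDownFrom (at (tabulate α)) M

    valid : Filling → Bool
    valid T = isSSYT μ T ∧ tabContent μ T α

    fillings : List Filling
    fillings = funsL M (funsL M (allFin M))

    record Recorded (ks : List (List ℕ)) (T : Filling) : Set where
      constructor recorded
      field
        recordedBy : applyDownFrom (shape μ T) M ≡ ks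

    at-α : ∀ {j} → (l : j < M) → at (tabulate α) j ≡ α (fromℕ< l)
    at-α l = trans (cong (at (tabulate α)) (sym (toℕ-fromℕ< l))) (at-tabulate α (fromℕ< l))

    chain-of-valid : ∀ {T} → valid T ≡ true → Chain (tabulate μ) αs (applyDownFrom (shape μ T) M)
    chain-of-valid {T} v with s , t ← ∧-true {isSSYT μ T} v =
      subst₂ (λ q a → Chain q a (applyDownFrom (shape μ T) M)) (shape-M μ antitone bounded T)
        (applyDownFrom-cong M λ {j} j<M → trans (cong (content μ T) (sym (toℕ-fromℕ< j<M)))
          (trans (tabContent-true {μ = μ} {T} {α} t (fromℕ< j<M)) (sym (at-α j<M))))
        (chain-of μ antitone bounded (isSSYT-true s) M)

    apart : AllPairs (λ T T′ → ¬ (∀ r c → T r c ≡ T′ r c)) fillings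
    apart = funsL-apart (λ f g → ∀ c → f c ≡ g c) M (funsL-apart _≡_ M (allFin-apart M))

    complete : ∀ (T : Filling) → Any (λ T′ → ∀ r c → T r c ≡ T′ r c) fillings
    complete T = funsL-complete (λ f g → ∀ c → f c ≡ g c) M T
      (λ r → funsL-complete _≡_ M (T r) (λ c → allFin-complete (T r c)))

    kostka-≤ : kostka μ α ≤ K (tabulate μ) αs
    kostka-≤ = length-≤ (λ T ks → Recorded ks T)
      (All.map (λ v → lose (∈-chains⁺ (chain-of-valid v)) (recorded refl)) (filterᵇ-All valid fillings))
      (AllPairs-with
        (λ {T} {T′} v v′ T≉T′ _ (recorded e) (recorded e′) → T≉T′ (shape-injective μ antitone bounded
          (isSSYT-true (proj₁ (∧-true {isSSYT μ T} v))) (isSSYT-true (proj₁ (∧-true {isSSYT μ T′} v′)))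
          (trans e (sym e′))))
        (filterᵇ-All valid fillings) (AllPairs.filter⁺ _ apart))

    module _ {ks} (ch : Chain (tabulate μ) αs ks) where

      len : length ks ≡ M
      len = trans (chain-length ch) (length-applyDownFrom (at (tabulate α)) M)

      at-μ : ∀ r → at (tabulate μ) (toℕ r) ≡ μ r
      at-μ = at-tabulate μ

      letter : Fin M → Fin M → ℕ
      letter r c = if toℕ c <ᵇ μ r then entry ks (toℕ r) (toℕ c) else 0

      in-μ : ∀ {r : Fin M} {c} → c < μ r → c < at (tabulate μ) (toℕ r)
      in-μ {r} {c} = subst (c <_) (sym (at-μ r))

      letter-in : ∀ {r c} → toℕ c < μ r → letter r c ≡ entry ks (toℕ r) (toℕ c)
      letter-in l rewrite <ᵇ-true⁻ l = refl

      letter-out : ∀ {r c} → ¬ toℕ c < μ r → letter r c ≡ 0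
      letter-out {r} {c} n with toℕ c <ᵇ μ r in e
      ... | true = ⊥-elim (n (<ᵇ-true e))
      ... | false = refl

      letter-< : ∀ r c → letter r c < M
      letter-< r c with toℕ c <ᵇ μ r in e
      ... | true = subst (entry ks (toℕ r) (toℕ c) <_) len (entry-< ch (in-μ {r} (<ᵇ-true e)))
      ... | false = s≤s z≤n

      -- `funsL` contains the filling with these letters only up to pointwise equality, so
      -- everything is shown for an arbitrary `T` that agrees with it.
      module _ {T : Filling} (T≡ : ∀ r c → clamp {N} (letter r c) ≡ T r c) where

        T-letter : ∀ r c → toℕ (T r c) ≡ letter r c
        T-letter r c = trans (cong toℕ (sym (T≡ r c))) (toℕ-clamp (letter-< r c))

        T-in : ∀ {r c} → toℕ c < μ r → toℕ (T r c) ≡ entry ks (toℕ r) (toℕ c)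
        T-in {r} {c} l = trans (T-letter r c) (letter-in l)

        T-ssyt : SSYT μ T
        T-ssyt = record
          { outside = λ r c n → toℕ-injective (trans (T-letter r c) (letter-out n))
          ; row = λ r {c} {c′} l s → subst₂ _≤_ (sym (T-in {r} (<-trans l s))) (sym (T-in {r} s))
            (entry-row ch l (in-μ {r} s))
          ; col = λ {r} {r′} c l s → subst₂ _<_ (sym (T-in {r} (<-≤-trans s (antitone l))))
            (sym (T-in {r′} s)) (entry-col ch l (in-μ {r′} s))
          }

        T-shape : applyDownFrom (shape μ T) M ≡ ks
        T-shape = trans (trans
          (applyDownFrom-cong M λ {j} _ → tabulate-cong λ r → #-cong λ c → cell j r c)
          (cong (applyDownFrom entryShape) (sym len)))
          (entry-levels ch (length-tabulate μ) λ r → at-bound r)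
          where
            entryShape : ℕ → List ℕ
            entryShape j = tabulate {n = M} (λ r → # {M} (λ c →
              (toℕ c <ᵇ at (tabulate μ) (toℕ r)) ∧ (entry ks (toℕ r) (toℕ c) <ᵇ j)))
            cell : ∀ j r c → (inShape μ r c ∧ (toℕ (T r c) <ᵇ j)) ≡
              ((toℕ c <ᵇ at (tabulate μ) (toℕ r)) ∧ (entry ks (toℕ r) (toℕ c) <ᵇ j))
            cell j r c rewrite at-μ r with toℕ c <ᵇ μ r in e
            ... | true = cong (_<ᵇ j) (T-in (<ᵇ-true e))
            ... | false = refl
            at-bound : ∀ r → at (tabulate μ) r ≤ M
            at-bound r with r <? M
            ... | yes l = subst (_≤ M)
              (trans (sym (at-μ (fromℕ< l))) (cong (at (tabulate μ)) (toℕ-fromℕ< l)))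
              (bounded (fromℕ< l))
            ... | no n = subst (_≤ M)
              (sym (at-outside (tabulate μ) (subst (_≤ r) (sym (length-tabulate μ)) (≮⇒≥ n)))) z≤n

        T-valid : valid T ≡ true
        T-valid = ∧-true⁻ (isSSYT-true⁻ T-ssyt) (tabContent-true⁻ {μ = μ} {T} {α} λ i →
          trans (+-cancelˡ-≡ (sum (shape μ T (toℕ i))) _ _
            (trans (shape-content μ T (toℕ i)) (sym (chain-contents {at (tabulate α)} {shape μ T} M
              (subst₂ (λ q k → Chain q αs k) (sym (shape-M μ antitone bounded T)) (sym T-shape) ch)
                (toℕ<n i)))))
            (at-tabulate α i))

      filling-of-chain : Any (Recorded ks) (filter (λ T → valid T Bool.≟ true) fillings)
      filling-of-chain = filterᵇ-Any valid
        (Any.map (λ T≡ → T-valid T≡ , recorded (T-shape T≡))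
          (complete (λ r c → clamp {N} (letter r c))))

    kostka-≥ : K (tabulate μ) αs ≤ kostka μ α
    kostka-≥ = length-≤ Recorded
      (All.map filling-of-chain (chains-All (tabulate μ) αs))
      (AllPairs.map (λ ks≢ T (recorded e) (recorded e′) → ks≢ (trans (sym e) e′))
        (chains-unique (tabulate μ) αs))

  kostka≡K : kostka μ α ≡ K (tabulate μ) (tabulate α)
  kostka≡K = trans (≤-antisym kostka-≤ kostka-≥)
    (K-↭ (subst (λ n → applyDownFrom (at (tabulate α)) n ↭ tabulate α)
    (length-tabulate α) (applyDownFrom-at (tabulate α))) (tabulate μ))

-- Sums over partitions, and two obstructions to Schur positivity

data Descending : ℕ → List ℕ → Set where
  [] : ∀ {b} → Descending b []
  _∷_ : ∀ {b x xs} → x ≤ b → Descending x xs → Descending b (x ∷ xs)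

-- parts k s b lists the descending sequences of k numbers ≤ b with sum s.
parts : ℕ → ℕ → ℕ → List (List ℕ)
parts zero zero b = [] ∷ []
parts zero (suc s) b = []
parts (suc k) s b = concatMap (λ x → map (x ∷_) (parts k (s ∸ x) x)) (upTo (suc (s ⊓ b)))

∈-parts⁺ : ∀ {b xs} → Descending b xs → xs ∈ parts (length xs) (sum xs) b
∈-parts⁺ [] = here refl
∈-parts⁺ {b} {x ∷ xs} (x≤b ∷ d) = ∈-concatMap⁺ (λ y → map (y ∷_) (parts (length xs) (x + sum xs ∸ y) y))
  (lose (∈-upTo⁺ (s≤s (⊓-glb (m≤m+n x (sum xs)) x≤b)))
    (∈-map⁺ (x ∷_) (subst (λ s → xs ∈ parts (length xs) s x) (sym (m+n∸m≡n x (sum xs))) (∈-parts⁺ d))))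

∈-parts⁻ : ∀ k s b {xs} → xs ∈ parts k s b → Descending b xs × length xs ≡ k × sum xs ≡ s
∈-parts⁻ zero zero b (here refl) = [] , refl , refl
∈-parts⁻ (suc k) s b m
  with x , x∈ , m′ ← find
    (∈-concatMap⁻ (λ y → map (y ∷_) (parts k (s ∸ y) y)) {xs = upTo (suc (s ⊓ b))} m)
  with xs , xs∈ , refl ← ∈-map⁻ (x ∷_) m′
  with d , l , e ← ∈-parts⁻ k (s ∸ x) x xs∈
  = m≤n⊓o⇒m≤o s b x≤ ∷ d , cong suc l , trans (cong (x +_) e) (m+[n∸m]≡n (m≤n⊓o⇒m≤n s b x≤))
  where x≤ = s≤s⁻¹ (∈-upTo⁻ x∈)

parts-unique : ∀ k s b → Unique (parts k s b)
parts-unique zero zero b = [] ∷ []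
parts-unique zero (suc s) b = []
parts-unique (suc k) s b = AllPairs.concat⁺
  (All.map⁺ (All.universal (λ x → Unique.map⁺ (proj₂ ∘ ∷-injective) (parts-unique k (s ∸ x) x)) xs))
  (AllPairs.map⁺ (AllPairs.map
    (λ {x} {y} x≢y → All.map⁺ (All.universal
       (λ _ → All.map⁺ (All.universal (λ _ e → x≢y (proj₁ (∷-injective e))) (parts k (s ∸ y) y)))
         (parts k (s ∸ x) x)))
    (Unique.upTo⁺ (suc (s ⊓ b)))))
  where xs = upTo (suc (s ⊓ b))

descending-tabulate : ∀ {k b} (f : Fin k → ℕ) → (∀ i → f i ≤ b) →
  (∀ {i j} → toℕ i < toℕ j → f j ≤ f i) →
  Descending b (tabulate f)
descending-tabulate {zero} f h a = []
descending-tabulate {suc k} f h a =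
  h zero ∷ descending-tabulate (f ∘ suc) (λ i → a (s≤s z≤n)) (λ l → a (s≤s l))

descending-at : ∀ {b xs} → Descending b xs → ∀ i → at xs i ≤ b
descending-at [] i = z≤n
descending-at (l ∷ d) zero = l
descending-at (l ∷ d) (suc i) = ≤-trans (descending-at d i) l

descending-antitone : ∀ {b xs} → Descending b xs → ∀ {i j} → i < j → at xs j ≤ at xs i
descending-antitone [] _ = z≤n
descending-antitone (l ∷ d) {zero} {suc j} _ = descending-at d j
descending-antitone (l ∷ d) {suc i} {suc j} (s≤s i<j) = descending-antitone d i<j

∑-≥ : ∀ {k} (f : Fin k → ℕ) i → f i ≤ ∑ f
∑-≥ f zero rewrite ∑-suc f = m≤m+n (f zero) _
∑-≥ f (suc i) rewrite ∑-suc f = ≤-trans (∑-≥ (f ∘ suc) i) (m≤n+m _ (f zero))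

record Partition {N} (μ : Fin N → ℕ) : Set where
  field
    antitone : ∀ {r r′} → toℕ r < toℕ r′ → μ r′ ≤ μ r
    total : ∑ μ ≡ N

  bounded : ∀ r → μ r ≤ N
  bounded r = subst (μ r ≤_) total (∑-≥ μ r)

isPartition-true : ∀ {N} (μ : Fin N → ℕ) → isPartition μ ≡ true → Partition μ
isPartition-true {N} μ e = record
  { antitone = λ {r} {r′} l → ≤ᵇ-true
    (⇒-true {ltF r r′} (allB⁻ _ (allB⁻ (λ i → allB λ j → not (ltF i j) ∨ (μ j ≤ᵇ μ i)) e₁ r) r′)
      (dec-true⁻ (r <F? r′) l))
  ; total = trans (sym (sum-allFin μ)) (≡ᵇ-true (proj₂ (∧-true {antitoneᵇ} e)))
  }
  where
    antitoneᵇ = allB λ i → allB λ j → not (ltF i j) ∨ (μ j ≤ᵇ μ i)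
    e₁ : antitoneᵇ ≡ true
    e₁ = proj₁ (∧-true e)

isPartition-true⁻ : ∀ {N} (μ : Fin N → ℕ) → Partition μ → isPartition μ ≡ true
isPartition-true⁻ {N} μ p = ∧-true⁻
  (allB⁺ _ λ i → allB⁺ (λ j → not (ltF i j) ∨ (μ j ≤ᵇ μ i)) λ j → ⇒-true⁻ {ltF i j} λ e →
    ≤ᵇ-true⁻ (antitone (dec-true (i <F? j) e)))
  (≡ᵇ-true⁻ (trans (sum-allFin μ) total))
  where open Partition p

partitions-All : ∀ N → All Partition (partitions N)
partitions-All N = All.map (λ {μ} → isPartition-true μ)
  (filterᵇ-All isPartition (map (λ f i → toℕ (f i)) (funsL N (allFin (suc N)))))

partition-parts : ∀ {N} {μ : Fin N → ℕ} → Partition μ → tabulate μ ∈ parts N N N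
partition-parts {N} {μ} p =
  subst₂ (λ k s → tabulate μ ∈ parts k s N) (length-tabulate μ) (trans (sym (∑-def μ)) total)
  (∈-parts⁺ (descending-tabulate μ bounded antitone))
  where open Partition p

parts-partition : ∀ {N q} → q ∈ parts N N N → Any (λ μ → Partition μ × tabulate μ ≡ q) (partitions N)
parts-partition {N} {q} q∈ with d , len , s ← ∈-parts⁻ N N N q∈ = filterᵇ-Any isPartition
  (Any.map⁺ (Any.map (λ {g} → good {g}) (funsL-complete _≡_ N index (λ i → allFin-complete (index i)))))
  where
    index : Fin N → Fin (suc N)
    index r = clamp (at q (toℕ r))
    good : ∀ {g} → (∀ r → index r ≡ g r) →
      isPartition (λ i → toℕ (g i)) ≡ true × Partition (λ i → toℕ (g i)) × tabulate (λ i → toℕ (g i))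
        ≡ q
    good {g} h = isPartition-true⁻ _ p , p , tab
      where
        g≡ : ∀ r → toℕ (g r) ≡ at q (toℕ r)
        g≡ r = trans (cong toℕ (sym (h r)))
          (toℕ-clamp (s≤s (descending-at (proj₁ (∈-parts⁻ N N N q∈)) (toℕ r))))
        tab : tabulate (λ i → toℕ (g i)) ≡ q
        tab = trans (tabulate-cong g≡) (tabulate-at N q (proj₁ (proj₂ (∈-parts⁻ N N N q∈))))
        p : Partition (λ i → toℕ (g i))
        p = record
          { antitone = λ {r} {r′} l → subst₂ _≤_ (sym (g≡ r′)) (sym (g≡ r))
            (descending-antitone (proj₁ (∈-parts⁻ N N N q∈)) l)
          ; total = trans (∑-def _) (trans (cong sum tab) (proj₂ (proj₂ (∈-parts⁻ N N N q∈)))) }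

partitions-apart : ∀ N → AllPairs (λ μ ν → ¬ (∀ i → μ i ≡ ν i)) (partitions N)
partitions-apart N = AllPairs.filter⁺ _
  (AllPairs.map⁺ (AllPairs.map (λ f≢g e → f≢g (λ i → toℕ-injective (e i)))
  (funsL-apart _≡_ N (allFin-apart (suc N)))))

-- Two weighted pigeonhole arguments, one for each inequality, pass from functions to lists. From
-- here on sums over partitions can be evaluated, because `parts` bounds each part by its
-- predecessor and by the remaining sum.
sum-partitions : ∀ N (F : List ℕ → ℕ) → sum (map (F ∘ tabulate) (partitions N)) ≡ sum
  (map F (parts N N N))
sum-partitions N F = ≤-antisym
  (pigeonhole (λ (μ : Fin N → ℕ) q → tabulate μ ≡ q) (F ∘ tabulate) F (λ e → ≤-reflexive (cong F e))
    (All.map (λ p → lose (partition-parts p) refl) (partitions-All N))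
    (AllPairs.map (λ {μ} {ν} μ≉ν _ e e′ → μ≉ν (tabulate-injective μ ν (trans e (sym e′))))
      (partitions-apart N)))
  (pigeonhole (λ q (μ : Fin N → ℕ) → tabulate μ ≡ q) F (F ∘ tabulate)
    (λ e → ≤-reflexive (cong F (sym e)))
    (All.tabulate {xs = parts N N N} (λ q∈ → Any.map proj₂ (parts-partition q∈)))
    (AllPairs.map (λ q≢q′ _ e e′ → q≢q′ (trans (sym e) e′)) (parts-unique N N N)))

kostka-partition : ∀ {N} {μ : Fin (suc N) → ℕ} → Partition μ → ∀ α → kostka μ α ≡ K (tabulate μ)
  (tabulate α)
kostka-partition p α = kostka≡K _ (Partition.antitone p) (Partition.bounded p) α

schur-sum : ∀ N (c : (Fin (suc N) → ℕ) → ℕ) α →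
  sum (map (λ μ → c μ * kostka μ α) (partitions (suc N))) ≡
  sum (map (λ μ → c μ * K (tabulate μ) (tabulate α)) (partitions (suc N)))
schur-sum N c α = cong sum
  (map-cong-All (λ {μ} p → cong (c μ *_) (kostka-partition p α)) (partitions-All (suc N)))

module _ {N : ℕ} {G : Graph (suc N)} where

  -- A positive coefficient at `α` comes from some μ with c μ > 0 and a positive Kostka number. The
  -- same μ contributes at `β`, where no negative term can cancel it.
  support-obstruction : ∀ α β → (∀ q → 0 < K q (tabulate α) → 0 < K q (tabulate β)) →
    0 < coeffX G α → coeffX G β ≡ 0 → ¬ SchurPositive G
  support-obstruction α β h pos zer (c , e)
    with μ , μ∈ , l ← find (sum-map-pos (λ μ → c μ * K (tabulate μ) (tabulate α)) (partitions (suc N))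
      (subst (0 <_) (trans (e α) (schur-sum N c α)) pos))
    = contradict (c μ) (K (tabulate μ) (tabulate α)) (K (tabulate μ) (tabulate β)) l
        (All.lookup (sum-map-zero (λ μ → c μ * K (tabulate μ) (tabulate β))
          (trans (sym (trans (e β) (schur-sum N c β))) zer)) μ∈)
        (h (tabulate μ))
    where
      contradict : ∀ a x y → 0 < a * x → a * y ≡ 0 → ¬ (0 < x → 0 < y)
      contradict zero x y l _ _ = n≮0 l
      contradict (suc a) zero y l _ _ = n≮0 (subst (0 <_) (*-zeroʳ a) l)
      contradict (suc a) (suc x) zero _ _ f = n≮0 (f (s≤s z≤n))

  weigh : {A : Set} → (A → ℕ) → List (ℕ × A) → ℕ
  weigh f = sum ∘ map λ (w , α) → w * f α

  -- An inequality valid for every Schur function survives nonnegative combinations, so it would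
  -- hold for the coefficients of X_G. Putting weights on both sides avoids signs.
  linear-obstruction : ∀ (as bs : List (ℕ × (Fin (suc N) → ℕ))) →
    All (λ q → weigh (K q ∘ tabulate) as ≤ weigh (K q ∘ tabulate) bs) (parts (suc N) (suc N) (suc N)) →
    weigh (coeffX G) bs < weigh (coeffX G) as → ¬ SchurPositive G
  linear-obstruction as bs h l (c , e) = <⇒≱ l (begin
    weigh (coeffX G) as
      ≡⟨ expand as ⟩
    sum (map (λ μ → c μ * weigh (K (tabulate μ) ∘ tabulate) as) (partitions (suc N)))
      ≤⟨ sum-map-≤ (λ {μ} p → *-monoʳ-≤ (c μ) (All.lookup h (partition-parts p)))
        (partitions-All (suc N)) ⟩
    sum (map (λ μ → c μ * weigh (K (tabulate μ) ∘ tabulate) bs) (partitions (suc N)))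
      ≡⟨ expand bs ⟨
    weigh (coeffX G) bs ∎)
    where
      open ≤-Reasoning
      expand : ∀ as → weigh (coeffX G) as ≡ sum
        (map (λ μ → c μ * weigh (K (tabulate μ) ∘ tabulate) as) (partitions (suc N)))
      expand [] = sym (trans (cong sum (map-cong (λ μ → *-zeroʳ (c μ)) (partitions (suc N))))
        (sum-map-0 (partitions (suc N))))
      expand ((w , α) ∷ as) = trans
        (cong₂ _+_ (trans (cong (w *_) (trans (e α) (schur-sum N c α)))
          (sum-map-* w _ (partitions (suc N)))) (expand as))
        (trans (sum-map-+ (λ μ → w * (c μ * K (tabulate μ) (tabulate α)))
          (λ μ → c μ * weigh (K (tabulate μ) ∘ tabulate) as) (partitions (suc N)))
          (cong sum (map-cong (λ μ → trans
            (cong (_+ c μ * weigh (K (tabulate μ) ∘ tabulate) as) (rearrange w (c μ) _))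
            (sym (*-distribˡ-+ (c μ) (w * K (tabulate μ) (tabulate α)) _))) (partitions (suc N)))))
        where
          rearrange : ∀ a b d → a * (b * d) ≡ b * (a * d)
          rearrange a b d = trans (sym (*-assoc a b d))
            (trans (cong (_* d) (*-comm a b)) (*-assoc b a d))

-- Proper colourings of a graph and of the fan

mult : ∀ {n k} → (Fin n → Fin k) → Fin k → ℕ
mult κ c = # (λ v → eqF (κ v) c)

Proper : ∀ {N} → Graph N → (Fin N → Fin N) → Set
Proper G κ = ∀ i j → G i j ≡ true → κ i ≢ κ j

isProper-true : ∀ {N} (G : Graph N) κ → isProper G κ ≡ true → Proper G κ
isProper-true G κ e i j g κ≡ = not-true {eqF (κ i) (κ j)}
  (⇒-true {G i j} (allB⁻ _ (allB⁻ (λ i → allB λ j → not (G i j) ∨ not (eqF (κ i) (κ j))) e i) j) g)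
  (dec-true⁻ (κ i ≟F κ j) κ≡)

isProper-true⁻ : ∀ {N} (G : Graph N) κ → Proper G κ → isProper G κ ≡ true
isProper-true⁻ G κ p = allB⁺ _ λ i → allB⁺ (λ j → not (G i j) ∨ not (eqF (κ i) (κ j))) λ j →
  ⇒-true⁻ {G i j} λ g → not-true⁻ λ e → p i j g (dec-true (κ i ≟F κ j) e)

colorContent-true : ∀ {N} (κ : Fin N → Fin N) α → colorContent κ α ≡ true → ∀ c → mult κ c ≡ α c
colorContent-true κ α e c = trans (sym (countL-# (λ v → eqF (κ v) c))) (≡ᵇ-true (allB⁻ _ e c))

colorContent-true⁻ : ∀ {N} (κ : Fin N → Fin N) α → (∀ c → mult κ c ≡ α c) → colorContent κ α ≡ true
colorContent-true⁻ κ α h = allB⁺ _ λ c → ≡ᵇ-true⁻ (trans (countL-# (λ v → eqF (κ v) c)) (h c))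

module _ {N : ℕ} (G : Graph N) where

  coloring : (Fin N → ℕ) → (Fin N → Fin N) → Bool
  coloring α κ = isProper G κ ∧ colorContent κ α

  coloring-true : ∀ {α κ} → coloring α κ ≡ true → Proper G κ × (∀ c → mult κ c ≡ α c)
  coloring-true {α} {κ} e with p , q ← ∧-true {isProper G κ} e =
    isProper-true G κ p , colorContent-true κ α q

  coloring-true⁻ : ∀ {α κ} → Proper G κ → (∀ c → mult κ c ≡ α c) → coloring α κ ≡ true
  coloring-true⁻ {α} {κ} p h = ∧-true⁻ (isProper-true⁻ G κ p) (colorContent-true⁻ κ α h)

  colorings-complete : (κ : Fin N → Fin N) → Any (λ κ′ → ∀ v → κ v ≡ κ′ v) (funsL N (allFin N))
  colorings-complete κ = funsL-complete _≡_ N κ (λ v → allFin-complete (κ v))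

  colorings-apart : AllPairs (λ κ κ′ → ¬ (∀ v → κ v ≡ κ′ v)) (funsL N (allFin N))
  colorings-apart = funsL-apart _≡_ N (allFin-apart N)

  module _ {α β : Fin N → ℕ} {σ τ : Fin N → Fin N} (στ : ∀ c → σ (τ c) ≡ c) (τσ : ∀ c → τ (σ c) ≡ c)
           (βσ : ∀ c → β (σ c) ≡ α c) where

    relabel-content : ∀ {κ κ′ : Fin N → Fin N} → (∀ v → σ (κ v) ≡ κ′ v) → (∀ c → mult κ c ≡ α c) → ∀ c →
      mult κ′ c ≡ β c
    relabel-content {κ} {κ′} h e c = trans
      (#-cong λ v → ⇔→≡
        (λ t → dec-true⁻ (κ v ≟F τ c)
          (trans (sym (τσ (κ v))) (cong τ (trans (h v) (dec-true (κ′ v ≟F c) t)))))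
        (λ t → dec-true⁻ (κ′ v ≟F c)
          (trans (sym (h v)) (trans (cong σ (dec-true (κ v ≟F τ c) t)) (στ c)))))
      (trans (e (τ c)) (trans (sym (βσ (τ c))) (cong β (στ c))))

    relabel-≤ : coeffX G α ≤ coeffX G β
    relabel-≤ = length-≤ (λ κ κ′ → ∀ v → σ (κ v) ≡ κ′ v)
      (All.map (λ {κ} t → let p , e = coloring-true {α} {κ} t in filterᵇ-Any (coloring β)
          (Any.map (λ {κ′} h → coloring-true⁻ {β} {κ′}
              (λ i j g κ′≡ → p i j g
                (trans (sym (τσ (κ i)))
                (trans (cong τ (trans (h i) (trans κ′≡ (sym (h j))))) (τσ (κ j)))))
              (relabel-content {κ} {κ′} h e) , h)
            (colorings-complete (σ ∘ κ))))
        (filterᵇ-All (coloring α) (funsL N (allFin N))))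
      (AllPairs.map (λ {κ} {κ′} κ≉κ′ _ h h′ → κ≉κ′ λ v → trans (sym (τσ (κ v)))
        (trans (cong τ (trans (h v) (sym (h′ v)))) (τσ (κ′ v))))
        (AllPairs.filter⁺ _ colorings-apart))

  -- A permutation of the contents induces a bijection of positions, which relabels the colours. The
  -- casts are there because this bijection acts on the indices of `tabulate α` and `tabulate β`,
  -- whose lengths equal `N` only propositionally.
  coeffX-↭ : ∀ {α β} → tabulate α ↭ tabulate β → coeffX G α ≡ coeffX G β
  coeffX-↭ {α} {β} p = ≤-antisym (relabel-≤ {α} {β} {σ} {τ} στ τσ βσ)
    (relabel-≤ {β} {α} {τ} {σ} τσ στ (λ c → trans (sym (βσ (τ c))) (cong β (στ c))))
    where
      open SetoidPerm (setoid ℕ) using (onIndices)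
      open SetoidPermProperties (setoid ℕ) using (onIndices-lookup)
      la = length-tabulate α
      lb = length-tabulate β
      π = onIndices (↭⇒↭ₛ p)
      σ τ : Fin N → Fin N
      σ i = cast lb (Inverse.to π (cast (sym la) i))
      τ j = cast la (Inverse.from π (cast (sym lb) j))
      στ : ∀ c → σ (τ c) ≡ c
      στ c = trans (cong (cast lb)
        (trans (cong (Inverse.to π) (cast-involutive (sym la) la _)) (Inverse.strictlyInverseˡ π _)))
        (cast-involutive lb (sym lb) c)
      τσ : ∀ c → τ (σ c) ≡ c
      τσ c = trans (cong (cast la)
        (trans (cong (Inverse.from π) (cast-involutive (sym lb) lb _)) (Inverse.strictlyInverseʳ π _)))
        (cast-involutive la (sym la) c)
      βσ : ∀ c → β (σ c) ≡ α c
      βσ c = begin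
        β (σ c)                                                    ≡⟨ lookup-tabulate β (σ c) ⟨
        List.lookup (tabulate β) (cast (sym lb) (σ c))        ≡⟨ cong (List.lookup (tabulate β))
          (cast-involutive (sym lb) lb _) ⟩
        List.lookup (tabulate β) (Inverse.to π (cast (sym la) c)) ≡⟨ onIndices-lookup (↭⇒↭ₛ p) _ ⟨
        List.lookup (tabulate α) (cast (sym la) c)            ≡⟨ lookup-tabulate α c ⟩
        α c ∎
        where open ≡-Reasoning

  coeffX-pos : ∀ {α} κ → Proper G κ → (∀ c → mult κ c ≡ α c) → 0 < coeffX G α
  coeffX-pos {α} κ p e = Any-length (filterᵇ-Any (coloring α) (Any.map
    (λ {κ′} h → coloring-true⁻ {α} {κ′} (λ i j g κ≡ → p i j g (trans (h i) (trans κ≡ (sym (h j)))))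
      (λ c → trans (#-cong λ v → cong (λ x → eqF x c) (sym (h v))) (e c)) , h)
    (colorings-complete κ)))
    where
      Any-length : ∀ {A : Set} {P : A → Set} {xs} → Any P xs → 0 < length xs
      Any-length (here _) = s≤s z≤n
      Any-length (there _) = s≤s z≤n

  coeffX-zero : ∀ {α} → (∀ κ → Proper G κ → ¬ (∀ c → mult κ c ≡ α c)) → coeffX G α ≡ 0
  coeffX-zero {α} h with filter (λ κ → coloring α κ Bool.≟ true) (funsL N (allFin N)) | filterᵇ-All
    (coloring α) (funsL N (allFin N))
  ... | [] | _ = refl
  ... | κ ∷ _ | t ∷ _ = let p , e = coloring-true {α} {κ} t in ⊥-elim (h κ p e)

record FanProper {N k} (m : ℕ) (κ : Fin N → Fin k) : Set where
  field
    cross : ∀ i j → toℕ i < m → m ≤ toℕ j → κ i ≢ κ j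
    path : ∀ i j → m ≤ toℕ i → toℕ j ≡ suc (toℕ i) → κ i ≢ κ j

module _ {m n : ℕ} {κ : Fin (m + n) → Fin (m + n)} where

  fan-proper : Proper (fan m n) κ → FanProper m κ
  fan-proper p = record
    { cross = λ i j l l′ → p i j (∨-introˡ (∧-true⁻ (<ᵇ-true⁻ l) (≤ᵇ-true⁻ l′)))
    ; path = λ i j l e → p i j
      (∨-introʳ {(toℕ i <ᵇ m) ∧ (m ≤ᵇ toℕ j)} (∨-introʳ {(toℕ j <ᵇ m) ∧ (m ≤ᵇ toℕ i)}
        (∧-true⁻ (≤ᵇ-true⁻ l) (∧-true⁻ (≤ᵇ-true⁻ (≤-trans l (≤-trans (n≤1+n _) (≤-reflexive (sym e)))))
          (∨-introˡ (≡ᵇ-true⁻ (trans (+-comm (toℕ i) 1) (sym e)))))))) }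

  fan-proper⁻ : FanProper m κ → Proper (fan m n) κ
  fan-proper⁻ p i j e with ∨-elim {(toℕ i <ᵇ m) ∧ (m ≤ᵇ toℕ j)} e
  ... | inj₁ t with l , l′ ← ∧-true {toℕ i <ᵇ m} t = cross i j (<ᵇ-true l) (≤ᵇ-true l′)
    where open FanProper p
  ... | inj₂ t with ∨-elim {(toℕ j <ᵇ m) ∧ (m ≤ᵇ toℕ i)} t
  ... | inj₁ t with l , l′ ← ∧-true {toℕ j <ᵇ m} t = cross j i (<ᵇ-true l) (≤ᵇ-true l′) ∘ sym
    where open FanProper p
  ... | inj₂ t with l , t′ ← ∧-true {m ≤ᵇ toℕ i} t with l′ , t″ ← ∧-true {m ≤ᵇ toℕ j} t′
    with ∨-elim {toℕ i + 1 ≡ᵇ toℕ j} t″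
  ... | inj₁ e = path i j (≤ᵇ-true l) (trans (sym (≡ᵇ-true e)) (+-comm (toℕ i) 1))
    where open FanProper p
  ... | inj₂ e = path j i (≤ᵇ-true l′) (trans (sym (≡ᵇ-true e)) (+-comm (toℕ j) 1)) ∘ sym
    where open FanProper p

-- Counting the colourings of a fan vertex by vertex

countL-funsL-suc : ∀ {B : Set} n (p : (Fin (suc n) → B) → Bool) (xs : List B) →
  countL p (funsL (suc n) xs) ≡ sum (map (λ x → countL (λ f → p (x ∷ᶠ f)) (funsL n xs)) xs)
countL-funsL-suc n p xs = go (funsL n xs)
  where
    go : ∀ fs → countL p (concatMap (λ f → map (λ x → x ∷ᶠ f) xs) fs) ≡ sum
      (map (λ x → countL (λ f → p (x ∷ᶠ f)) fs) xs)
    go [] = sym (sum-map-0 xs)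
    go (f ∷ fs) = begin
      countL p (heads ++ rest)                                 ≡⟨ countL-sum p (heads ++ rest) ⟩
      sum (map (𝟙 ∘ p) (heads ++ rest))                        ≡⟨ cong sum (map-++ (𝟙 ∘ p) heads rest) ⟩
      sum (map (𝟙 ∘ p) heads ++ map (𝟙 ∘ p) rest)              ≡⟨ sum-++ (map (𝟙 ∘ p) heads) _ ⟩
      sum (map (𝟙 ∘ p) heads) + sum (map (𝟙 ∘ p) rest)
        ≡⟨ cong₂ _+_ (cong sum (sym (map-∘ xs))) (trans (sym (countL-sum p rest)) (go fs)) ⟩
      sum (map (λ x → 𝟙 (p (x ∷ᶠ f))) xs) + sum (map (λ x → countL (λ f → p (x ∷ᶠ f)) fs) xs)
        ≡⟨ sum-map-+ _ _ xs ⟩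
      sum (map (λ x → 𝟙 (p (x ∷ᶠ f)) + countL (λ f → p (x ∷ᶠ f)) fs) xs)
        ≡⟨ cong sum (map-cong (λ x → sym (countL-∷ (λ f → p (x ∷ᶠ f)))) xs) ⟩
      sum (map (λ x → countL (λ f → p (x ∷ᶠ f)) (f ∷ fs)) xs)  ∎
      where
        open ≡-Reasoning
        heads = map (λ x → x ∷ᶠ f) xs
        rest = concatMap (λ f → map (λ x → x ∷ᶠ f) xs) fs
        countL-∷ : ∀ q → countL q (f ∷ fs) ≡ 𝟙 (q f) + countL q fs
        countL-∷ q with q f
        ... | true = refl
        ... | false = refl

module _ {k : ℕ} where

  spendAt : Vec ℕ k → Fin k → ℕ → Maybe (Vec ℕ k)
  spendAt β c zero = nothing
  spendAt β c (suc b) = just (β [ c ]≔ b)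

  -- β records how often each colour may still be used.
  spend : Vec ℕ k → Fin k → Maybe (Vec ℕ k)
  spend β c = spendAt β c (lookup β c)

  exhausted : ∀ {k} → Vec ℕ k → Bool
  exhausted [] = true
  exhausted (zero ∷ β) = exhausted β
  exhausted (suc _ ∷ β) = false

  differs : Maybe (Fin k) → Fin k → Bool
  differs nothing c = true
  differs (just d) c = not (toℕ d ≡ᵇ toℕ c)

  pathAccepts : ∀ {n} → Maybe (Fin k) → Vec ℕ k → (Fin n → Fin k) → Bool
  pathAccepts {zero} last β κ = exhausted β
  pathAccepts {suc n} last β κ =
    differs last (κ zero) ∧ maybe (λ β → pathAccepts (just (κ zero)) β (κ ∘ suc)) false
      (spend β (κ zero))

  pathCount : ℕ → Maybe (Fin k) → Vec ℕ k → ℕ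
  pathCount zero last β = 𝟙 (exhausted β)
  pathCount (suc n) last β = sum (map
    (λ c → if differs last c then maybe (pathCount n (just c)) 0 (spend β c) else 0) (allFin k))

  -- The test is made once the independent vertices are coloured; `α` is the initial budget and `β`
  -- what is left. All that is left must be spent on the path, so a partly spent colour would occur
  -- on both sides of the join.
  untouched : ∀ {k} → Vec ℕ k → Vec ℕ k → Bool
  untouched [] [] = true
  untouched (zero ∷ β) (_ ∷ α) = untouched β α
  untouched (suc b ∷ β) (a ∷ α) = (suc b ≡ᵇ a) ∧ untouched β α

  fanAccepts : ∀ m {n} → Vec ℕ k → Vec ℕ k → (Fin (m + n) → Fin k) → Bool
  fanAccepts zero α β κ = untouched β α ∧ pathAccepts nothing β κ
  fanAccepts (suc m) α β κ = maybe (λ β → fanAccepts m α β (κ ∘ suc)) false (spend β (κ zero))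

  fanCount : ℕ → ℕ → Vec ℕ k → Vec ℕ k → ℕ
  fanCount zero n α β = if untouched β α then pathCount n nothing β else 0
  fanCount (suc m) n α β = sum (map (λ c → maybe (fanCount m n α) 0 (spend β c)) (allFin k))

  countL-path : ∀ n last β → countL (pathAccepts last β) (funsL n (allFin k)) ≡ pathCount n last β
  countL-path zero last β with exhausted β
  ... | true = refl
  ... | false = refl
  countL-path (suc n) last β = trans (countL-funsL-suc n (pathAccepts last β) (allFin k))
    (cong sum (map-cong branch (allFin k)))
    where
      branch : ∀ c → countL (λ κ → pathAccepts {suc n} last β (c ∷ᶠ κ)) (funsL n (allFin k)) ≡
        (if differs last c then maybe (pathCount n (just c)) 0 (spend β c) else 0)
      branch c with differs last c | spend β c
      ... | false | _ = countL-false (funsL n (allFin k))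
      ... | true | nothing = countL-false (funsL n (allFin k))
      ... | true | just β′ = countL-path n (just c) β′

  countL-fan : ∀ m n α β → countL (fanAccepts m α β) (funsL (m + n) (allFin k)) ≡ fanCount m n α β
  countL-fan zero n α β with untouched β α
  ... | false = countL-false (funsL n (allFin k))
  ... | true = countL-path n nothing β
  countL-fan (suc m) n α β = trans (countL-funsL-suc (m + n) (fanAccepts (suc m) α β) (allFin k))
    (cong sum (map-cong branch (allFin k)))
    where
      branch : ∀ c → countL (λ κ → fanAccepts (suc m) α β (c ∷ᶠ κ)) (funsL (m + n) (allFin k)) ≡
        maybe (fanCount m n α) 0 (spend β c)
      branch c with spend β c
      ... | nothing = countL-false (funsL (m + n) (allFin k))
      ... | just β′ = countL-fan m n α β′

  Content : ∀ {n} → Vec ℕ k → (Fin n → Fin k) → Set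
  Content β κ = ∀ c → mult κ c ≡ lookup β c

  mult-suc : ∀ {n} (κ : Fin (suc n) → Fin k) c → mult κ c ≡ 𝟙 (eqF (κ zero) c) + mult (κ ∘ suc) c
  mult-suc κ c = #-suc (λ v → eqF (κ v) c)

  eqF-refl : (c : Fin k) → eqF c c ≡ true
  eqF-refl c = dec-true⁻ (c ≟F c) refl

  eqF-≢ : {c d : Fin k} → c ≢ d → eqF c d ≡ false
  eqF-≢ {c} {d} c≢d with c ≟F d
  ... | yes e = ⊥-elim (c≢d e)
  ... | no _ = refl

  spend-content : ∀ {n β β′} {κ : Fin (suc n) → Fin k} → spend β (κ zero) ≡ just β′ → Content β′
    (κ ∘ suc) → Content β κ
  spend-content {β = β} {κ = κ} e h c with lookup β (κ zero) in eq
  spend-content {β = β} {κ = κ} refl h c | suc b with κ zero ≟F c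
  ... | yes refl = trans (mult-suc κ c)
    (trans (cong₂ _+_ (cong 𝟙 (eqF-refl c)) (trans (h c) (lookup∘update c β b))) (sym eq))
  ... | no ≢ = trans (mult-suc κ c)
    (cong₂ _+_ (cong 𝟙 (eqF-≢ ≢)) (trans (h c) (lookup∘update′ (≢ ∘ sym) β b)))

  spend-content⁻ : ∀ {n β} {κ : Fin (suc n) → Fin k} → Content β κ → ∃ λ β′ → spend β (κ zero) ≡ just β′
    × Content β′ (κ ∘ suc)
  spend-content⁻ {β = β} {κ} h with lookup β (κ zero) in eq
  ... | zero = ⊥-elim (1+n≢0
    (trans (trans (cong (_+ mult (κ ∘ suc) (κ zero)) (cong 𝟙 (sym (eqF-refl (κ zero)))))
    (sym (mult-suc κ (κ zero)))) (trans (h (κ zero)) eq)))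
  ... | suc b = β [ κ zero ]≔ b , refl , content′
    where
      content′ : Content (β [ κ zero ]≔ b) (κ ∘ suc)
      content′ c with κ zero ≟F c
      ... | yes refl = trans
        (suc-injective (trans
        (trans (cong (_+ mult (κ ∘ suc) c) (cong 𝟙 (sym (eqF-refl c)))) (sym (mult-suc κ c)))
        (trans (h c) eq)))
        (sym (lookup∘update c β b))
      ... | no ≢ = trans (trans (cong (λ b → 𝟙 b + mult (κ ∘ suc) c) (sym (eqF-≢ ≢)))
        (trans (sym (mult-suc κ c)) (h c)))
        (sym (lookup∘update′ (≢ ∘ sym) β b))

  exhausted-true : ∀ {k} (β : Vec ℕ k) → exhausted β ≡ true → ∀ c → lookup β c ≡ 0
  exhausted-true (zero ∷ β) e zero = refl
  exhausted-true (zero ∷ β) e (suc c) = exhausted-true β e c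

  exhausted-true⁻ : ∀ {k} (β : Vec ℕ k) → (∀ c → lookup β c ≡ 0) → exhausted β ≡ true
  exhausted-true⁻ [] h = refl
  exhausted-true⁻ (x ∷ β) h rewrite h zero = exhausted-true⁻ β (h ∘ suc)

  untouched-true : ∀ {k} (β α : Vec ℕ k) → untouched β α ≡ true → ∀ c → lookup β c ≢ 0 → lookup β c
    ≡ lookup α c
  untouched-true (zero ∷ β) (_ ∷ α) e zero n = ⊥-elim (n refl)
  untouched-true (zero ∷ β) (_ ∷ α) e (suc c) n = untouched-true β α e c n
  untouched-true (suc b ∷ β) (a ∷ α) e zero n = ≡ᵇ-true (proj₁ (∧-true {suc b ≡ᵇ a} e))
  untouched-true (suc b ∷ β) (a ∷ α) e (suc c) n =
    untouched-true β α (proj₂ (∧-true {suc b ≡ᵇ a} e)) c n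

  untouched-true⁻ : ∀ {k} (β α : Vec ℕ k) → (∀ c → lookup β c ≢ 0 → lookup β c ≡ lookup α c) →
    untouched β α ≡ true
  untouched-true⁻ [] [] h = refl
  untouched-true⁻ (zero ∷ β) (_ ∷ α) h = untouched-true⁻ β α (h ∘ suc)
  untouched-true⁻ (suc b ∷ β) (a ∷ α) h =
    ∧-true⁻ (≡ᵇ-true⁻ (h zero λ ())) (untouched-true⁻ β α (h ∘ suc))

  mult-zero : (κ : Fin 0 → Fin k) → ∀ c → mult κ c ≡ 0
  mult-zero κ c = trans (#-def (λ v → eqF (κ v) c)) (∑-zero _)

  Consecutive : ∀ {n} → ℕ → (Fin n → Fin k) → Set
  Consecutive m κ = ∀ i j → m ≤ toℕ i → toℕ j ≡ suc (toℕ i) → κ i ≢ κ j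

  Starts : ∀ {n} → Maybe (Fin k) → (Fin n → Fin k) → Set
  Starts {n} last κ = ∀ i → toℕ i ≡ 0 → differs last (κ i) ≡ true

  path-accepts : ∀ {n last β} {κ : Fin n → Fin k} → pathAccepts last β κ ≡ true →
    Content β κ × Consecutive 0 κ × Starts last κ
  path-accepts {zero} {last} {β} {κ} e = (λ c → trans (mult-zero κ c) (sym (exhausted-true β e c))) ,
    (λ ()) , λ ()
  path-accepts {suc n} {last} {β} {κ} e with spend β (κ zero) in eq | ∧-true {differs last (κ zero)} e
  ... | just β′ | d , t with h , p , s ← path-accepts {n} {just (κ zero)} {β′} {κ ∘ suc} t =
    spend-content {β = β} {κ = κ} eq h , consecutive , λ { zero _ → d }
    where
      consecutive : Consecutive 0 κ
      consecutive zero (suc j) _ e κ≡ = not-true (s j (suc-injective e)) (≡ᵇ-true⁻ (cong toℕ κ≡))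
      consecutive (suc i) (suc j) _ e = p i j z≤n (suc-injective e)

  path-accepts⁻ : ∀ {n last β} {κ : Fin n → Fin k} → Content β κ → Consecutive 0 κ → Starts last κ →
    pathAccepts last β κ ≡ true
  path-accepts⁻ {zero} {last} {β} {κ} h p s = exhausted-true⁻ β λ c → trans (sym (h c)) (mult-zero κ c)
  path-accepts⁻ {suc n} {last} {β} {κ} h p s with spend-content⁻ {β = β} {κ = κ} h
  ... | β′ , eq , h′ rewrite eq = ∧-true⁻ (s zero refl)
    (path-accepts⁻ {n} {just (κ zero)} {β′} {κ ∘ suc} h′
      (λ i j _ e → p (suc i) (suc j) z≤n (cong suc e))
      λ i e → not-true⁻ λ t → p zero (suc i) z≤n (cong suc e) (toℕ-injective (≡ᵇ-true t)))

  -- A colour still needed by the path has not been used before.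
  Separated : ∀ {n} → ℕ → Vec ℕ k → Vec ℕ k → (Fin n → Fin k) → Set
  Separated m α β κ = ∀ j → m ≤ toℕ j → lookup β (κ j) ≡ lookup α (κ j) × (∀ i → toℕ i < m → κ i ≢ κ j)

  Bounded : Vec ℕ k → Vec ℕ k → Set
  Bounded β α = ∀ c → lookup β c ≤ lookup α c

  spend-lookup : ∀ {β β′ c} → spend β c ≡ just β′ → lookup β c ≡ suc (lookup β′ c) ×
    (∀ d → d ≢ c → lookup β′ d ≡ lookup β d)
  spend-lookup {β} {c = c} e with lookup β c in eq
  spend-lookup {β} {c = c} refl | suc b =
    cong suc (sym (lookup∘update c β b)) , λ d d≢c → lookup∘update′ d≢c β b

  spend-bounded : ∀ {α β β′ c} → spend β c ≡ just β′ → Bounded β α → Bounded β′ α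
  spend-bounded {α} {β} {β′} {c} e b d with d ≟F c | spend-lookup {β} e
  ... | yes refl | l , _ = ≤-trans (n≤1+n _) (≤-trans (≤-reflexive (sym l)) (b d))
  ... | no d≢c | _ , f = ≤-trans (≤-reflexive (f d d≢c)) (b d)

  mult-pos : ∀ {n} (κ : Fin n → Fin k) i → mult κ (κ i) ≢ 0
  mult-pos κ zero e = 1+n≢0
    (trans (cong (λ b → 𝟙 b + mult (κ ∘ suc) (κ zero)) (sym (eqF-refl (κ zero))))
    (trans (sym (mult-suc κ (κ zero))) e))
  mult-pos κ (suc i) e =
    mult-pos (κ ∘ suc) i (m+n≡0⇒n≡0 (𝟙 (eqF (κ zero) (κ (suc i))))
    (trans (sym (mult-suc κ (κ (suc i)))) e))

  mult-pos⁻ : ∀ {n} (κ : Fin n → Fin k) c → mult κ c ≢ 0 → ∃ λ i → κ i ≡ c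
  mult-pos⁻ {zero} κ c n = ⊥-elim (n (mult-zero κ c))
  mult-pos⁻ {suc n} κ c ne with κ zero ≟F c
  ... | yes e = zero , e
  ... | no ≢ with i , e ← mult-pos⁻ (κ ∘ suc) c
    (λ z → ne (trans (mult-suc κ c) (cong₂ _+_ (cong 𝟙 (eqF-≢ ≢)) z))) = suc i , e

  fan-accepts : ∀ m {n α β} {κ : Fin (m + n) → Fin k} → Bounded β α → fanAccepts m α β κ ≡ true →
    Content β κ × Consecutive m κ × Separated m α β κ
  fan-accepts zero {α = α} {β} {κ} b e with u , t ← ∧-true {untouched β α} e
    with h , p , _ ← path-accepts {last = nothing} {β} {κ} t =
    h , p , λ j _ → untouched-true β α u (κ j) (λ z → mult-pos κ j (trans (h (κ j)) z)) , λ _ ()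
  fan-accepts (suc m) {α = α} {β} {κ} b e with spend β (κ zero) in eq
  ... | just β′ with h , p , s ← fan-accepts m {α = α} {β′} {κ ∘ suc} (spend-bounded {α} {β} eq b) e =
    spend-content {β = β} {κ = κ} eq h ,
    (λ { (suc i) (suc j) (s≤s l) e → p i j l (suc-injective e) }) , separated
    where
      separated : Separated (suc m) α β κ
      separated (suc j) (s≤s l) with s j l
      ... | e , f = trans (sym (proj₂ (spend-lookup {β} eq) (κ (suc j)) (κ≢ ∘ sym))) e ,
        λ { zero _ → κ≢ ; (suc i) (s≤s l) → f i l }
        where
          κ≢ : κ zero ≢ κ (suc j)
          -- If the colours were equal, the budget after spending would still be the full `α`, so
          -- before spending it would have exceeded `α`.
          κ≢ κ≡ = 1+n≰n (≤-trans (≤-reflexive (sym (proj₁ (spend-lookup {β} eq))))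
            (≤-trans (b (κ zero))
              (≤-reflexive (sym (subst (λ c → lookup β′ c ≡ lookup α c) (sym κ≡) e)))))

  fan-accepts⁻ : ∀ m {n α β} {κ : Fin (m + n) → Fin k} → Content β κ → Consecutive m κ →
    Separated m α β κ → fanAccepts m α β κ ≡ true
  fan-accepts⁻ zero {α = α} {β} {κ} h p s = ∧-true⁻
    (untouched-true⁻ β α λ c ne → let i , e = mult-pos⁻ κ c (λ z → ne (trans (sym (h c)) z)) in
      subst (λ c → lookup β c ≡ lookup α c) e (proj₁ (s i z≤n)))
    (path-accepts⁻ {last = nothing} {β} {κ} h p λ _ _ → refl)
  fan-accepts⁻ (suc m) {α = α} {β} {κ} h p s with spend-content⁻ {β = β} {κ = κ} h
  ... | β′ , eq , h′ rewrite eq =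
    fan-accepts⁻ m {α = α} {β′} {κ ∘ suc} h′ (λ i j l e → p (suc i) (suc j) (s≤s l) (cong suc e))
    λ j l → let e , f = s (suc j) (s≤s l) in
      trans (proj₂ (spend-lookup {β} eq) (κ (suc j)) (f zero (s≤s z≤n) ∘ sym)) e , λ i l′ → f (suc i)
        (s≤s l′)

coeffX-fan : ∀ m n α → coeffX (fan m n) α ≡ fanCount m n (Vec.tabulate α) (Vec.tabulate α)
coeffX-fan m n α = trans
  (countL-cong (λ κ → ⇔→≡ {coloring (fan m n) α κ} (to κ) (from κ)) (funsL (m + n) (allFin (m + n))))
  (countL-fan m n v v)
  where
    v = Vec.tabulate α
    to : ∀ κ → coloring (fan m n) α κ ≡ true → fanAccepts m v v κ ≡ true
    to κ e with p , h ← coloring-true (fan m n) {α} {κ} e =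
      fan-accepts⁻ m {n} {v} {v} {κ} (λ c → trans (h c) (sym (lookup∘tabulate α c)))
      (FanProper.path fp) (λ j l → refl , λ i l′ → FanProper.cross fp i j l′ l)
      where fp = fan-proper {m} {n} {κ} (proj₁ (coloring-true (fan m n) {α} {κ} e))
    from : ∀ κ → fanAccepts m v v κ ≡ true → coloring (fan m n) α κ ≡ true
    from κ e with h , p , s ← fan-accepts m {α = v} {v} {κ} (λ _ → ≤-refl) e =
      coloring-true⁻ (fan m n) {α} {κ}
      (fan-proper⁻ {m} {n} {κ} (record { cross = λ i j l l′ → proj₂ (s j l′) i l ; path = p }))
      (λ c → trans (h c) (lookup∘tabulate α c))

-- The Schur positive fans

linked-descending : ∀ {b x xs} → x ≤ b → Linked (λ x y → y ≤ x) (x ∷ xs) → Descending b (x ∷ xs)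
linked-descending l [-] = l ∷ []
linked-descending l (l′ ∷ ls) = l ∷ linked-descending l′ ls

sorted-descending : ∀ {b xs} → sum xs ≤ b → Linked (λ x y → y ≤ x) xs → Descending b xs
sorted-descending _ [] = []
sorted-descending {xs = x ∷ xs} l ls@([-]) = linked-descending (≤-trans (m≤m+n x (sum xs)) l) ls
sorted-descending {xs = x ∷ xs} l ls@(_ ∷ _) = linked-descending (≤-trans (m≤m+n x (sum xs)) l) ls

chain-sum : ∀ {q α ks} → Chain q α ks → sum α ≡ sum q
chain-sum (done []) = refl
chain-sum {x ∷ q} (done (z ∷ zs)) rewrite z = chain-sum (done zs)
chain-sum {α = a ∷ α} (step {p} _ e c) = trans (trans (cong (a +_) (chain-sum c)) (+-comm a (sum p))) e

K-zero : ∀ q α → sum α ≢ sum q → K q α ≡ 0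
K-zero q α ne with K q α in e
... | zero = refl
... | suc _ with _ , c ← K-pos⁻ q α (subst (0 <_) (sym e) (s≤s z≤n)) = ⊥-elim (ne (chain-sum c))

∑-indicator : ∀ {k} (c : Fin k) → # (eqF c) ≡ 1
∑-indicator {suc k} zero =
  trans (#-suc (eqF zero)) (cong suc (#-false {p = λ c → eqF zero (suc c)} λ i ()))
∑-indicator {suc k} (suc c) =
  trans (#-suc (eqF (suc c)))
  (trans (#-cong (λ i → trans (eqF-≡ᵇ (suc c) (suc i)) (sym (eqF-≡ᵇ c i)))) (∑-indicator c))

∑-mult : ∀ {n k} (κ : Fin n → Fin k) → ∑ (mult κ) ≡ n
∑-mult {n} κ = trans (∑-cong λ c → #-def (λ v → eqF (κ v) c))
  (trans (sym (∑-swap (λ v c → 𝟙 (eqF (κ v) c))))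
    (trans (∑-cong (λ v → trans (sym (#-def (eqF (κ v)))) (∑-indicator (κ v)))) (∑-1 n)))

vec : ∀ N → List ℕ → Vec ℕ N
vec N a = Vec.tabulate (at a ∘ toℕ)

module _ {m n : ℕ} where

  private
    N = suc m + n
    G = fan (suc m) n

  positive-criterion : (C : List ℕ → ℕ) →
    All (λ a → fanCount (suc m) n (vec N a) (vec N a) ≡ sum (map (λ q → C q * K q a) (parts N N N)))
      (parts N N N) →
    SchurPositive G
  positive-criterion C h =
    C ∘ tabulate , λ α → trans (expand α) (sym (trans (schur-sum (m + n) (C ∘ tabulate) α)
      (sum-partitions N λ q → C q * K q (tabulate α))))
    where
      expand : ∀ α → coeffX G α ≡ sum (map (λ q → C q * K q (tabulate α)) (parts N N N))
      expand α with ∑ α ≟ N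
      -- A content whose total is not N belongs to no colouring of N vertices and to no tableau with
      -- N cells, so both sides vanish.
      ... | no ne = trans (coeffX-zero G (λ κ _ e → ne (trans (sym (∑-cong e)) (∑-mult κ))))
        (sym (trans (cong sum
          (map-cong-All {P = λ q → sum q ≡ N} (λ {q} s → trans (cong (C q *_) (K-zero q (tabulate α)
            λ e → ne (trans (∑-def α) (trans e s)))) (*-zeroʳ (C q)))
              (All.tabulate λ {q} q∈ → proj₂ (proj₂ (∈-parts⁻ N N N q∈)))))
          (sum-map-0 (parts N N N))))
      ... | yes total = begin
        coeffX G α                                              ≡⟨ coeffX-↭ G {α} {β}
          (↭-trans (↭-sym a↭) (↭-reflexive (sym tab))) ⟩
        coeffX G β                                              ≡⟨ coeffX-fan (suc m) n β ⟩
        fanCount (suc m) n (vec N a) (vec N a)                  ≡⟨ All.lookup h a∈ ⟩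
        sum (map (λ q → C q * K q a) (parts N N N))
          ≡⟨ cong sum (map-cong (λ q → cong (C q *_) (K-↭ a↭ q)) (parts N N N)) ⟩
        sum (map (λ q → C q * K q (tabulate α)) (parts N N N))  ∎
        where
          open ≡-Reasoning
          a = sort (tabulate α)
          a↭ : a ↭ tabulate α
          a↭ = sort-↭ (tabulate α)
          len : length a ≡ N
          len = trans (↭-length a↭) (length-tabulate α)
          a-sum : sum a ≡ N
          a-sum = trans (sum-↭ a↭) (trans (sym (∑-def α)) total)
          a∈ : a ∈ parts N N N
          a∈ = subst₂ (λ k s → a ∈ parts k s N) len a-sum
            (∈-parts⁺ (sorted-descending (≤-reflexive a-sum) (sort-↗ (tabulate α))))
          β : Fin N → ℕ
          β i = at a (toℕ i)
          tab : tabulate β ≡ a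
          tab = tabulate-at N a len

allᵇ : {A : Set} → (A → Bool) → List A → Bool
allᵇ p [] = true
allᵇ p (x ∷ xs) = p x ∧ allᵇ p xs

allᵇ-true : ∀ {A : Set} {p : A → Bool} xs → allᵇ p xs ≡ true → All (λ x → p x ≡ true) xs
allᵇ-true [] e = []
allᵇ-true {p = p} (x ∷ xs) e with e₁ , e₂ ← ∧-true {p x} e = e₁ ∷ allᵇ-true xs e₂

coefficient : List (List ℕ × ℕ) → List ℕ → ℕ
coefficient [] q = 0
coefficient ((p , c) ∷ t) q with ≡-dec _≟_ p q
... | yes _ = c
... | no _ = coefficient t q

nonzero : List ℕ → List ℕ
nonzero [] = []
nonzero (zero ∷ q) = nonzero q
nonzero (suc x ∷ q) = suc x ∷ nonzero q

-- Matching on the coefficient first leaves `K q a` unevaluated at shapes whose coefficient is 0.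
scale : ℕ → ℕ → ℕ
scale zero x = 0
scale (suc c) x = suc c * x

scale≡* : ∀ c x → scale c x ≡ c * x
scale≡* zero x = refl
scale≡* (suc c) x = refl

check : (m n : ℕ) → List (List ℕ × ℕ) → Bool
check m n t = allᵇ (λ a → fanCount m n (vec N a) (vec N a) ≡ᵇ
  sum (map (λ q → scale (coefficient t (nonzero q)) (K q a)) (parts N N N))) (parts N N N)
  where N = m + n

-- A record, so that FanPositive m n is compared by its indices, without unfolding
-- the enumerations behind SchurPositive.
record FanPositive (m n : ℕ) : Set where
  constructor fanPositive
  field
    schurPositive : SchurPositive (fan m n)

check-positive : ∀ m n t → 1 ≤ m → check m n t ≡ true → FanPositive m n
check-positive (suc m) n t _ e =
  fanPositive (positive-criterion {m} {n} (coefficient t ∘ nonzero) (All.map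
  (λ {a} e → trans (≡ᵇ-true e)
    (cong sum (map-cong (λ q → scale≡* (coefficient t (nonzero q)) (K q a)) (parts N N N))))
  (allᵇ-true (parts N N N) e)))
  where N = suc m + n

-- The tables here and below list the nonzero Schur coefficients of X_G, with the zero parts of the
-- shapes omitted; `refl` runs the comparison over all partitions of m + n.
fan-1-1 : FanPositive 1 1
fan-1-1 = check-positive 1 1 ((1 ∷ 1 ∷ [] , 2) ∷ []) (s≤s z≤n) refl

fan-1-2 : FanPositive 1 2
fan-1-2 = check-positive 1 2 ((1 ∷ 1 ∷ 1 ∷ [] , 6) ∷ []) (s≤s z≤n) refl

fan-1-3 : FanPositive 1 3
fan-1-3 = check-positive 1 3 ((2 ∷ 1 ∷ 1 ∷ [] , 2) ∷ (1 ∷ 1 ∷ 1 ∷ 1 ∷ [] , 18) ∷ []) (s≤s z≤n) refl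

fan-1-4 : FanPositive 1 4
fan-1-4 = check-positive 1 4
  ((2 ∷ 2 ∷ 1 ∷ [] , 2) ∷ (2 ∷ 1 ∷ 1 ∷ 1 ∷ [] , 14) ∷ (1 ∷ 1 ∷ 1 ∷ 1 ∷ 1 ∷ [] , 54) ∷ []) (s≤s z≤n) refl

fan-2-1 : FanPositive 2 1
fan-2-1 = check-positive 2 1 ((2 ∷ 1 ∷ [] , 1) ∷ (1 ∷ 1 ∷ 1 ∷ [] , 4) ∷ []) (s≤s z≤n) refl

fan-2-2 : FanPositive 2 2
fan-2-2 = check-positive 2 2 ((2 ∷ 1 ∷ 1 ∷ [] , 2) ∷ (1 ∷ 1 ∷ 1 ∷ 1 ∷ [] , 18) ∷ []) (s≤s z≤n) refl

fan-2-3 : FanPositive 2 3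
fan-2-3 = check-positive 2 3
  ((2 ∷ 2 ∷ 1 ∷ [] , 2) ∷ (2 ∷ 1 ∷ 1 ∷ 1 ∷ [] , 8) ∷ (1 ∷ 1 ∷ 1 ∷ 1 ∷ 1 ∷ [] , 78) ∷ []) (s≤s z≤n) refl

fan-2-4 : FanPositive 2 4
fan-2-4 = check-positive 2 4
  ((2 ∷ 2 ∷ 2 ∷ [] , 6) ∷ (2 ∷ 2 ∷ 1 ∷ 1 ∷ [] , 10) ∷ (2 ∷ 1 ∷ 1 ∷ 1 ∷ 1 ∷ [] , 54) ∷
  (1 ∷ 1 ∷ 1 ∷ 1 ∷ 1 ∷ 1 ∷ [] , 330) ∷ []) (s≤s z≤n) refl

fan-2-5 : FanPositive 2 5
fan-2-5 = check-positive 2 5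
  ((3 ∷ 2 ∷ 2 ∷ [] , 2) ∷ (3 ∷ 2 ∷ 1 ∷ 1 ∷ [] , 2) ∷ (3 ∷ 1 ∷ 1 ∷ 1 ∷ 1 ∷ [] , 14) ∷
  (2 ∷ 2 ∷ 2 ∷ 1 ∷ [] , 26) ∷ (2 ∷ 2 ∷ 1 ∷ 1 ∷ 1 ∷ [] , 56) ∷ (2 ∷ 1 ∷ 1 ∷ 1 ∷ 1 ∷ 1 ∷ [] , 366) ∷
  (1 ∷ 1 ∷ 1 ∷ 1 ∷ 1 ∷ 1 ∷ 1 ∷ [] , 1374) ∷ []) (s≤s z≤n) refl

fan-2-6 : FanPositive 2 6
fan-2-6 = check-positive 2 6
  ((3 ∷ 3 ∷ 2 ∷ [] , 2) ∷ (3 ∷ 3 ∷ 1 ∷ 1 ∷ [] , 2) ∷ (3 ∷ 2 ∷ 2 ∷ 1 ∷ [] , 14) ∷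
  (3 ∷ 2 ∷ 1 ∷ 1 ∷ 1 ∷ [] , 44) ∷ (3 ∷ 1 ∷ 1 ∷ 1 ∷ 1 ∷ 1 ∷ [] , 212) ∷ (2 ∷ 2 ∷ 2 ∷ 2 ∷ [] , 68) ∷
  (2 ∷ 2 ∷ 2 ∷ 1 ∷ 1 ∷ [] , 50) ∷ (2 ∷ 2 ∷ 1 ∷ 1 ∷ 1 ∷ 1 ∷ [] , 410) ∷
  (2 ∷ 1 ∷ 1 ∷ 1 ∷ 1 ∷ 1 ∷ 1 ∷ [] , 2238) ∷ (1 ∷ 1 ∷ 1 ∷ 1 ∷ 1 ∷ 1 ∷ 1 ∷ 1 ∷ [] , 5658) ∷ [])
  (s≤s z≤n) refl

fan-3-4 : FanPositive 3 4
fan-3-4 = check-positive 3 4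
  ((3 ∷ 2 ∷ 2 ∷ [] , 2) ∷ (3 ∷ 2 ∷ 1 ∷ 1 ∷ [] , 4) ∷ (3 ∷ 1 ∷ 1 ∷ 1 ∷ 1 ∷ [] , 8) ∷
  (2 ∷ 2 ∷ 2 ∷ 1 ∷ [] , 4) ∷ (2 ∷ 2 ∷ 1 ∷ 1 ∷ 1 ∷ [] , 70) ∷ (2 ∷ 1 ∷ 1 ∷ 1 ∷ 1 ∷ 1 ∷ [] , 300) ∷
  (1 ∷ 1 ∷ 1 ∷ 1 ∷ 1 ∷ 1 ∷ 1 ∷ [] , 1902) ∷ []) (s≤s z≤n) refl

-- Stable partitions of the fan

-- Pick n β t s k: the k colours whose total multiplicity s goes to the path on n
-- vertices have been chosen among the colours with multiplicities β; the others
-- cover t independent vertices.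
data Pick (n : ℕ) : List ℕ → ℕ → ℕ → ℕ → Set where
  [] : Pick n [] 0 0 0
  off : ∀ {b β t s k} → Pick n β t s k → Pick n (b ∷ β) (b + t) s k
  on : ∀ {b β t s k} → 2 * b ≤ suc n → Pick n β t s k → Pick n (b ∷ β) t (b + s) (suc k)

-- In the application `x` and `y` count the uses of a colour on the independent vertices and on the
-- path; the edges across the join make one of the two vanish.
pick-tabulate : ∀ {n k} (f x y : Fin k → ℕ) → (∀ c → f c ≡ x c + y c) → (∀ c → x c ≡ 0 ⊎ y c ≡ 0) →
  (∀ c → 2 * y c ≤ suc n) →
  ∃ (Pick n (tabulate f) (∑ x) (∑ y))
pick-tabulate {n} {zero} f x y e d l =
  0 , subst₂ (λ t s → Pick n [] t s 0) (sym (∑-zero x)) (sym (∑-zero y)) []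
pick-tabulate {n} {suc k} f x y e d l with d zero | pick-tabulate (f ∘ suc) (x ∘ suc) (y ∘ suc)
  (e ∘ suc) (d ∘ suc) (l ∘ suc)
... | inj₁ z | j , p = suc j , subst₂ (λ t s → Pick n (tabulate f) t s (suc j))
        (sym (trans (∑-suc x) (cong (_+ ∑ (x ∘ suc)) z)))
        (trans (cong (_+ ∑ (y ∘ suc)) f≡) (sym (∑-suc y)))
        (on (subst (λ b → 2 * b ≤ suc n) (sym f≡) (l zero)) p)
  where
    f≡ : f zero ≡ y zero
    f≡ = trans (e zero) (cong (_+ y zero) z)
... | inj₂ z | j , p = j , subst₂ (λ t s → Pick n (tabulate f) t s j)
        (trans (cong (_+ ∑ (x ∘ suc)) f≡) (sym (∑-suc x)))
        (sym (trans (∑-suc y) (cong (_+ ∑ (y ∘ suc)) z)))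
        (off p)
  where
    f≡ : f zero ≡ x zero
    f≡ = trans (e zero) (trans (cong (x zero +_) z) (+-identityʳ (x zero)))

pick-zeros : ∀ {n} i {t s k} → Pick n (replicate i 0) t s k → t ≡ 0 × s ≡ 0
pick-zeros zero [] = refl , refl
pick-zeros (suc i) (off p) = pick-zeros i p
pick-zeros (suc i) (on _ p) = pick-zeros i p

pick-++-zeros : ∀ {n} β i {t s k} → Pick n (β ++ replicate i 0) t s k → ∃ (Pick n β t s)
pick-++-zeros [] i p with refl , refl ← pick-zeros i p = 0 , []
pick-++-zeros (b ∷ β) i (off p) = proj₁ r , off (proj₂ r)
  where r = pick-++-zeros β i p
pick-++-zeros (b ∷ β) i (on l p) = suc (proj₁ r) , on l (proj₂ r)
  where r = pick-++-zeros β i p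

-- Each path colour accounts for at most (n + 1)/2. At s = n this rules out a single path colour as
-- soon as n ≥ 2, which justifies the last test of `refute`.
pick-bound : ∀ {n β t s k} → Pick n β t s k → 2 * s ≤ k * suc n
pick-bound [] = z≤n
pick-bound (off p) = pick-bound p
pick-bound {n} (on {b} {s = s} {k} l p) =
  ≤-trans (≤-reflexive (*-distribˡ-+ 2 b s)) (+-mono-≤ l (pick-bound p))

tabulate-at-zeros : ∀ N β → length β ≤ N → tabulate {n = N} (at β ∘ toℕ) ≡ β ++ replicate
  (N ∸ length β) 0
tabulate-at-zeros N [] _ = zeros N
  where
    zeros : ∀ N → tabulate {n = N} (λ _ → 0) ≡ replicate N 0
    zeros zero = refl
    zeros (suc N) = cong (0 ∷_) (zeros N)
tabulate-at-zeros (suc N) (b ∷ β) (s≤s l) = cong (b ∷_) (tabulate-at-zeros N β l)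

mult-split : ∀ m {n k} (κ : Fin (m + n) → Fin k) c → mult κ c ≡ mult (κ ∘ (_↑ˡ n)) c + mult
  (κ ∘ (m ↑ʳ_)) c
mult-split zero {n} κ c = cong (_+ mult κ c) (sym (mult-zero (κ ∘ (_↑ˡ n)) c))
mult-split (suc m) {n} κ c = begin
  mult κ c                                              ≡⟨ mult-suc κ c ⟩
  𝟙 (eqF (κ zero) c) + mult (κ ∘ suc) c                 ≡⟨ cong (𝟙 (eqF (κ zero) c) +_)
    (mult-split m (κ ∘ suc) c) ⟩
  𝟙 (eqF (κ zero) c) + (mult (κ ∘ suc ∘ (_↑ˡ n)) c + mult (κ ∘ suc ∘ (m ↑ʳ_)) c)
    ≡⟨ +-assoc (𝟙 (eqF (κ zero) c)) _ _ ⟨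
  𝟙 (eqF (κ zero) c) + mult (κ ∘ suc ∘ (_↑ˡ n)) c + mult (κ ∘ suc ∘ (m ↑ʳ_)) c
    ≡⟨ cong (_+ mult (κ ∘ suc ∘ (m ↑ʳ_)) c) (mult-suc (κ ∘ (_↑ˡ n)) c) ⟨
  mult (κ ∘ (_↑ˡ n)) c + mult (κ ∘ (suc m ↑ʳ_)) c       ∎
  where open ≡-Reasoning

-- The second, sharper bound carries the induction: after a first vertex of colour `c` the next one
-- has another colour, so the sharper bound holds for the tail and leaves room for the vertex just
-- counted.
path-mult : ∀ {n k} (κ : Fin n → Fin k) c → Consecutive 0 κ →
  2 * mult κ c ≤ suc n × ((∀ i → toℕ i ≡ 0 → κ i ≢ c) → 2 * mult κ c ≤ n)
path-mult {zero} κ c p rewrite mult-zero κ c = z≤n , λ _ → z≤n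
path-mult {suc n} κ c p with κ zero ≟F c | path-mult (κ ∘ suc) c
  (λ i j _ e → p (suc i) (suc j) z≤n (cong suc e))
... | yes e | _ , l =
  subst (λ x → 2 * x ≤ suc (suc n)) (sym mult-head)
  (≤-trans (≤-reflexive (double-suc (mult (κ ∘ suc) c)))
        (s≤s (s≤s (l (λ i i≡0 κ≡ → p zero (suc i) z≤n (cong suc i≡0) (trans e (sym κ≡))))))) ,
          λ h → ⊥-elim (h zero refl e)
  where
    mult-head : mult κ c ≡ suc (mult (κ ∘ suc) c)
    mult-head = trans (mult-suc κ c) (cong (λ b → 𝟙 b + mult (κ ∘ suc) c) (dec-true⁻ (κ zero ≟F c) e))
    double-suc : ∀ x → 2 * suc x ≡ suc (suc (2 * x))
    double-suc = solve-∀
... | no ne | l , _ = ≤-trans l′ (n≤1+n _) , λ _ → l′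
  where
    l′ : 2 * mult κ c ≤ suc n
    l′ = subst (λ x → 2 * x ≤ suc n)
      (sym (trans (mult-suc κ c) (cong (λ b → 𝟙 b + mult (κ ∘ suc) c) (eqF-≢ ne)))) l

fan-pick : ∀ m n {k} (κ : Fin (m + n) → Fin k) → FanProper m κ → ∃ (Pick n (tabulate (mult κ)) m n)
fan-pick m n κ p = proj₁ picked , subst₂ (λ t s → Pick n (tabulate (mult κ)) t s (proj₁ picked))
  (∑-mult u) (∑-mult v) (proj₂ picked)
  where
    open FanProper p
    u = κ ∘ (_↑ˡ n)
    v = κ ∘ (m ↑ʳ_)
    apart : ∀ c → mult u c ≡ 0 ⊎ mult v c ≡ 0
    apart c with mult u c ≟ 0 | mult v c ≟ 0
    ... | yes z | _ = inj₁ z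
    ... | no _ | yes z = inj₂ z
    ... | no nu | no nv with i , e ← mult-pos⁻ u c nu with j , e′ ← mult-pos⁻ v c nv =
      ⊥-elim (cross (i ↑ˡ n) (m ↑ʳ j) (subst (_< m) (sym (toℕ-↑ˡ i n)) (toℕ<n i))
        (subst (m ≤_) (sym (toℕ-↑ʳ m j)) (m≤m+n m _)) (trans e (sym e′)))
    consecutive : Consecutive 0 v
    consecutive i j _ e = path (m ↑ʳ i) (m ↑ʳ j) (subst (m ≤_) (sym (toℕ-↑ʳ m i)) (m≤m+n m _))
      (trans (toℕ-↑ʳ m j) (trans (cong (m +_) e)
        (trans (+-suc m (toℕ i)) (cong suc (sym (toℕ-↑ʳ m i))))))
    picked = pick-tabulate {n} (mult κ) (mult u) (mult v) (mult-split m κ) apart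
      (λ c → proj₁ (path-mult v c consecutive))

unstable : ∀ m n β i → length (β ++ replicate i 0) ≤ m + n → (∀ {k} → ¬ Pick n β m n k) →
  coeffX (fan m n) (at (β ++ replicate i 0) ∘ toℕ) ≡ 0
unstable m n β i l ¬pick = coeffX-zero (fan m n) λ κ p e →
  let k , q = fan-pick m n κ (fan-proper {m} {n} {κ} p)
      k′ , q′ = pick-++-zeros (β ++ replicate i 0) (m + n ∸ length (β ++ replicate i 0))
        (subst (λ b → Pick n b m n k)
          (trans (tabulate-cong e) (tabulate-at-zeros (m + n) (β ++ replicate i 0) l)) q)
      k″ , q″ = pick-++-zeros β i q′
  in ¬pick {k″} q″

-- An affine form c + b j + d e in two natural parameters, with coefficients (c , b , d).
Affine : Set
Affine = ℕ × ℕ × ℕ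

infixl 6 _⊕_
_⊕_ : Affine → Affine → Affine
(c , b , d) ⊕ (c′ , b′ , d′) = c + c′ , b + b′ , d + d′

infix 4 _≺_
-- The comparison is coefficientwise and hence only sufficient, but a positive answer holds for all
-- values of the two parameters at once.
_≺_ : Affine → Affine → Bool
(c , b , d) ≺ (c′ , b′ , d′) = (c <ᵇ c′) ∧ (b ≤ᵇ b′) ∧ (d ≤ᵇ d′)

-- Tries all choices of colours in Pick; t and s are the totals assigned so far, k
-- counts the colours of the path.  A path on n ≥ 2 vertices needs two colours.
refute : Affine → Affine → List Affine → (t s : Affine) → ℕ → Bool
refute m n [] t s k = (t ≺ m) ∨ (m ≺ t) ∨ (s ≺ n) ∨ (n ≺ s) ∨ (k ≤ᵇ 1) ∧ ((1 , 0 , 0) ≺ n)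
refute m n (b ∷ β) t s k =
  refute m n β (t ⊕ b) s k ∧ (((1 , 0 , 0) ⊕ n ≺ b ⊕ b) ∨ refute m n β t (s ⊕ b) (suc k))

module _ (j e : ℕ) where

  infixr 7 _·_
  -- `b · x` is `suc b * x` without a final `+ 0`. Like the separate clauses of `⟦_⟧`, this makes a
  -- form such as (3 , 1 , 1) reduce to `3 + (j + e)`, so that the types produced by balancing match
  -- definitionally.
  _·_ : ℕ → ℕ → ℕ
  zero · x = x
  suc b · x = x + b · x

  ⟦_⟧ : Affine → ℕ
  ⟦ c , zero , zero ⟧ = c
  ⟦ c , suc b , zero ⟧ = c + b · j
  ⟦ c , zero , suc d ⟧ = c + d · e
  ⟦ c , suc b , suc d ⟧ = c + (b · j + d · e)

  ·-* : ∀ b x → b · x ≡ suc b * x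
  ·-* zero x = sym (+-identityʳ x)
  ·-* (suc b) x = cong (x +_) (·-* b x)

  ⟦⟧-def : ∀ c b d → ⟦ c , b , d ⟧ ≡ c + (b * j + d * e)
  ⟦⟧-def c zero zero = sym (+-identityʳ c)
  ⟦⟧-def c (suc b) zero = cong (c +_) (trans (·-* b j) (sym (+-identityʳ (suc b * j))))
  ⟦⟧-def c zero (suc d) = cong (c +_) (·-* d e)
  ⟦⟧-def c (suc b) (suc d) = cong (c +_) (cong₂ _+_ (·-* b j) (·-* d e))

  ⟦⟧-⊕ : ∀ x y → ⟦ x ⊕ y ⟧ ≡ ⟦ x ⟧ + ⟦ y ⟧
  ⟦⟧-⊕ (c , b , d) (c′ , b′ , d′) = begin
    ⟦ c + c′ , b + b′ , d + d′ ⟧                       ≡⟨ ⟦⟧-def (c + c′) (b + b′) (d + d′) ⟩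
    c + c′ + ((b + b′) * j + (d + d′) * e)             ≡⟨ rearrange c c′ b b′ d d′ j e ⟩
    c + (b * j + d * e) + (c′ + (b′ * j + d′ * e))     ≡⟨ cong₂ _+_ (⟦⟧-def c b d) (⟦⟧-def c′ b′ d′) ⟨
    ⟦ c , b , d ⟧ + ⟦ c′ , b′ , d′ ⟧                   ∎
    where
      open ≡-Reasoning
      rearrange : ∀ c c′ b b′ d d′ j e →
        c + c′ + ((b + b′) * j + (d + d′) * e) ≡ c + (b * j + d * e) + (c′ + (b′ * j + d′ * e))
      rearrange = solve-∀

  ≺-sound : ∀ x y → (x ≺ y) ≡ true → ⟦ x ⟧ < ⟦ y ⟧
  ≺-sound (c , b , d) (c′ , b′ , d′) t
    with l , t′ ← ∧-true {c <ᵇ c′} t with l′ , l″ ← ∧-true {b ≤ᵇ b′} t′ =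
    subst₂ _<_ (sym (⟦⟧-def c b d)) (sym (⟦⟧-def c′ b′ d′))
      (+-mono-<-≤ {c} {c′} (<ᵇ-true l)
        (+-mono-≤ (*-monoˡ-≤ j (≤ᵇ-true {b} {b′} l′)) (*-monoˡ-≤ e (≤ᵇ-true {d} {d′} l″))))

  -- Invariant of the search: `T` and `S` are the totals assigned so far, `t` and `s` those still to
  -- come, and `k` and `l` count the path colours in the same way. The final inequality is what
  -- `pick-bound` gives for the whole list.
  refute-sound : ∀ M N β T S k → refute M N β T S k ≡ true → ∀ {t s l} → Pick ⟦ N ⟧ (map ⟦_⟧ β) t s l →
    ⟦ T ⟧ + t ≡ ⟦ M ⟧ → ⟦ S ⟧ + s ≡ ⟦ N ⟧ → ¬ 2 * ⟦ N ⟧ ≤ (k + l) * suc ⟦ N ⟧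
  refute-sound M N [] T S k r [] eT eS l with ∨-elim {T ≺ M} r
  ... | inj₁ x = <⇒≢ (≺-sound T M x) (trans (sym (+-identityʳ _)) eT)
  ... | inj₂ r with ∨-elim {M ≺ T} r
  ... | inj₁ x = <⇒≢ (≺-sound M T x) (sym (trans (sym (+-identityʳ _)) eT))
  ... | inj₂ r with ∨-elim {S ≺ N} r
  ... | inj₁ x = <⇒≢ (≺-sound S N x) (trans (sym (+-identityʳ _)) eS)
  ... | inj₂ r with ∨-elim {N ≺ S} r
  ... | inj₁ x = <⇒≢ (≺-sound N S x) (sym (trans (sym (+-identityʳ _)) eS))
  -- With at most one path colour the bound reads 2 n ≤ n + 1, contrary to 1 < n.
  ... | inj₂ r with k≤1 , x ← ∧-true {k ≤ᵇ 1} r =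
    <⇒≱ (≺-sound (1 , 0 , 0) N x) (+-cancelʳ-≤ ⟦ N ⟧ ⟦ N ⟧ 1 (begin
      ⟦ N ⟧ + ⟦ N ⟧              ≡⟨ cong (⟦ N ⟧ +_) (sym (+-identityʳ ⟦ N ⟧)) ⟩
      2 * ⟦ N ⟧                  ≤⟨ l ⟩
      (k + 0) * suc ⟦ N ⟧        ≤⟨ *-monoˡ-≤ (suc ⟦ N ⟧)
        (≤-trans (≤-reflexive (+-identityʳ k)) (≤ᵇ-true k≤1)) ⟩
      1 * suc ⟦ N ⟧              ≡⟨ *-identityˡ (suc ⟦ N ⟧) ⟩
      1 + ⟦ N ⟧                  ∎))
    where open ≤-Reasoning
  refute-sound M N (b ∷ β) T S k r (off {t = t} p) eT eS =
    refute-sound M N β (T ⊕ b) S k (proj₁ (∧-true r)) p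
      (trans (cong (_+ t) (⟦⟧-⊕ T b)) (trans (+-assoc ⟦ T ⟧ ⟦ b ⟧ t) eT)) eS
  refute-sound M N (b ∷ β) T S k r (on {s = s} {l} h p) eT eS
    with ∨-elim {(1 , 0 , 0) ⊕ N ≺ b ⊕ b} (proj₂ (∧-true {refute M N β (T ⊕ b) S k} r))
  ... | inj₁ x = λ _ → <⇒≱ (≺-sound ((1 , 0 , 0) ⊕ N) (b ⊕ b) x)
          (≤-trans (≤-reflexive (trans (⟦⟧-⊕ b b) (cong (⟦ b ⟧ +_) (sym (+-identityʳ ⟦ b ⟧)))))
            (≤-trans h (≤-reflexive (sym (⟦⟧-⊕ (1 , 0 , 0) N)))))
  ... | inj₂ r = λ x → refute-sound M N β T (S ⊕ b) (suc k) r p eT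
          (trans (cong (_+ s) (⟦⟧-⊕ S b)) (trans (+-assoc ⟦ S ⟧ ⟦ b ⟧ s) eS))
          (subst (λ z → 2 * ⟦ N ⟧ ≤ z * suc ⟦ N ⟧) (+-suc k l) x)

  refuted : ∀ M N β → refute M N β (0 , 0 , 0) (0 , 0 , 0) 0 ≡ true → ∀ {k} → ¬ Pick ⟦ N ⟧
    (map ⟦_⟧ β) ⟦ M ⟧ ⟦ N ⟧ k
  refuted M N β r p = refute-sound M N β (0 , 0 , 0) (0 , 0 , 0) 0 r p refl refl (pick-bound p)

-- The stable partition with path blocks ⌈ n /2⌉ and ⌊ n /2⌋ and the m independent
-- vertices divided into blocks of sizes a and m - a.
parity : ℕ → ℕ
parity 0 = 0
parity 1 = 1
parity (suc (suc x)) = parity x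

colour : ℕ → ℕ → ℕ → ℕ
colour a m x = if x <ᵇ m then (if x <ᵇ a then 2 else 3) else parity (x ∸ m)

count : ℕ → (ℕ → ℕ) → ℕ → ℕ
count zero g y = 0
count (suc n) g y = 𝟙 (g 0 ≡ᵇ y) + count n (g ∘ suc) y

count-+ : ∀ m n g y → count (m + n) g y ≡ count m g y + count n (g ∘ (m +_)) y
count-+ zero n g y = refl
count-+ (suc m) n g y =
  trans (cong (𝟙 (g 0 ≡ᵇ y) +_) (count-+ m n (g ∘ suc) y)) (sym (+-assoc (𝟙 (g 0 ≡ᵇ y)) _ _))

count-cong : ∀ n {g h} y → (∀ {x} → x < n → g x ≡ h x) → count n g y ≡ count n h y
count-cong zero y e = refl
count-cong (suc n) y e =
  cong₂ _+_ (cong (λ z → 𝟙 (z ≡ᵇ y)) (e (s≤s z≤n))) (count-cong n y (λ l → e (s≤s l)))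

count-const : ∀ n z y → count n (λ _ → z) y ≡ n * 𝟙 (z ≡ᵇ y)
count-const zero z y = refl
count-const (suc n) z y = cong (𝟙 (z ≡ᵇ y) +_) (count-const n z y)

count-parity : ∀ n y → count n parity y ≡ at (⌈ n /2⌉ ∷ ⌊ n /2⌋ ∷ []) y
count-parity zero zero = refl
count-parity zero (suc zero) = refl
count-parity zero (suc (suc y)) = refl
count-parity (suc zero) zero = refl
count-parity (suc zero) (suc zero) = refl
count-parity (suc zero) (suc (suc y)) = refl
count-parity (suc (suc n)) zero = cong suc (count-parity n zero)
count-parity (suc (suc n)) (suc zero) = cong suc (count-parity n 1)
count-parity (suc (suc n)) (suc (suc y)) = count-parity n (suc (suc y))

count-colour : ∀ a b n y → count (a + b + n) (colour a (a + b)) y ≡ at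
  (⌈ n /2⌉ ∷ ⌊ n /2⌋ ∷ a ∷ b ∷ []) y
count-colour a b n y = begin
  count (a + b + n) g y                                        ≡⟨ count-+ (a + b) n g y ⟩
  count (a + b) g y + count n (g ∘ (a + b +_)) y               ≡⟨ cong (_+ count n (g ∘ (a + b +_)) y)
    (count-+ a b g y) ⟩
  count a g y + count b (g ∘ (a +_)) y + count n (g ∘ (a + b +_)) y
    ≡⟨ cong₂ _+_ (cong₂ _+_ (trans (count-cong a y (λ {x} → first x)) (count-const a 2 y))
                            (trans (count-cong b y (λ {x} → second x)) (count-const b 3 y)))
                 (trans (count-cong n y (λ {x} _ → third x)) (count-parity n y)) ⟩
  a * 𝟙 (2 ≡ᵇ y) + b * 𝟙 (3 ≡ᵇ y) + at (⌈ n /2⌉ ∷ ⌊ n /2⌋ ∷ []) y ≡⟨ total y ⟩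
  at (⌈ n /2⌉ ∷ ⌊ n /2⌋ ∷ a ∷ b ∷ []) y                        ∎
  where
    open ≡-Reasoning
    g = colour a (a + b)
    first : ∀ x → x < a → g x ≡ 2
    first x l rewrite <ᵇ-true⁻ (<-≤-trans l (m≤m+n a b)) | <ᵇ-true⁻ l = refl
    <ᵇ-false : ∀ x y → y ≤ x → (x <ᵇ y) ≡ false
    <ᵇ-false x y l with x <ᵇ y in e
    ... | false = refl
    ... | true = ⊥-elim (<⇒≱ (<ᵇ-true e) l)
    second : ∀ x → x < b → g (a + x) ≡ 3
    second x l rewrite <ᵇ-true⁻ (+-monoʳ-< a l) | <ᵇ-false (a + x) a (m≤m+n a x) = refl
    third : ∀ x → g (a + b + x) ≡ parity x
    third x rewrite <ᵇ-false (a + b + x) (a + b) (m≤m+n (a + b) x) | m+n∸m≡n (a + b) x = refl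
    total : ∀ y → a * 𝟙 (2 ≡ᵇ y) + b * 𝟙 (3 ≡ᵇ y) + at (⌈ n /2⌉ ∷ ⌊ n /2⌋ ∷ []) y ≡ at
      (⌈ n /2⌉ ∷ ⌊ n /2⌋ ∷ a ∷ b ∷ []) y
    total 0 rewrite *-zeroʳ a | *-zeroʳ b = refl
    total 1 rewrite *-zeroʳ a | *-zeroʳ b = refl
    total 2 rewrite *-identityʳ a | *-zeroʳ b | +-identityʳ a | +-identityʳ a = refl
    total 3 rewrite *-zeroʳ a | *-identityʳ b | +-identityʳ b = refl
    total (suc (suc (suc (suc y)))) rewrite *-zeroʳ a | *-zeroʳ b = refl

count-# : ∀ n (g : ℕ → ℕ) y → # {n} (λ v → g (toℕ v) ≡ᵇ y) ≡ count n g y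
count-# zero g y = trans (#-def _) (∑-zero _)
count-# (suc n) g y = trans (#-suc _) (cong (𝟙 (g 0 ≡ᵇ y) +_) (count-# n (g ∘ suc) y))

parity-≤1 : ∀ x → parity x ≤ 1
parity-≤1 0 = z≤n
parity-≤1 1 = s≤s z≤n
parity-≤1 (suc (suc x)) = parity-≤1 x

parity-suc : ∀ x → parity x ≢ parity (suc x)
parity-suc 0 = λ ()
parity-suc 1 = λ ()
parity-suc (suc (suc x)) = parity-suc x

colour-independent : ∀ a m {x} → x < m → 2 ≤ colour a m x × colour a m x ≤ 3
colour-independent a m {x} l rewrite <ᵇ-true⁻ l with x <ᵇ a
... | true = ≤-refl , n≤1+n 2
... | false = n≤1+n 2 , ≤-refl

colour-path : ∀ a m {x} → m ≤ x → colour a m x ≡ parity (x ∸ m)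
colour-path a m {x} l with x <ᵇ m in e
... | false = refl
... | true = ⊥-elim (<⇒≱ (<ᵇ-true e) l)

colour-≤3 : ∀ a m x → colour a m x ≤ 3
colour-≤3 a m x with x <? m
... | yes l = proj₂ (colour-independent a m l)
... | no n = subst (_≤ 3) (sym (colour-path a m (≮⇒≥ n))) (≤-trans (parity-≤1 (x ∸ m)) (s≤s z≤n))

stable : ∀ a b m n → a + b ≡ suc m → 4 ≤ suc m + n →
  0 < coeffX (fan (suc m) n) (at (⌈ n /2⌉ ∷ ⌊ n /2⌋ ∷ a ∷ b ∷ []) ∘ toℕ)
stable a b m n eq l =
  coeffX-pos (fan (suc m) n) κ (fan-proper⁻ {suc m} {n} {κ} (record { cross = cross ; path = path }))
  λ c → trans (#-cong (λ v → trans (eqF-≡ᵇ (κ v) c) (cong (_≡ᵇ toℕ c) (toℕ-κ v))))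
    (trans (count-# (suc m + n) g (toℕ c))
      (subst (λ m → count (m + n) (colour a m) (toℕ c) ≡ at (⌈ n /2⌉ ∷ ⌊ n /2⌋ ∷ a ∷ b ∷ []) (toℕ c)) eq
      (count-colour a b n (toℕ c))))
  where
    g = colour a (suc m)
    κ : Fin (suc m + n) → Fin (suc m + n)
    κ v = clamp (g (toℕ v))
    toℕ-κ : ∀ v → toℕ (κ v) ≡ g (toℕ v)
    toℕ-κ v = toℕ-clamp (<-≤-trans (s≤s (colour-≤3 a (suc m) (toℕ v))) l)
    g≡ : ∀ {i j} → κ i ≡ κ j → g (toℕ i) ≡ g (toℕ j)
    g≡ {i} {j} e = trans (sym (toℕ-κ i)) (trans (cong toℕ e) (toℕ-κ j))
    cross : ∀ i j → toℕ i < suc m → suc m ≤ toℕ j → κ i ≢ κ j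
    cross i j l l′ e = <⇒≢
      (≤-trans (s≤s (parity-≤1 (toℕ j ∸ suc m))) (proj₁ (colour-independent a (suc m) l)))
      (sym (trans (g≡ {i} {j} e) (colour-path a (suc m) l′)))
    path : ∀ i j → suc m ≤ toℕ i → toℕ j ≡ suc (toℕ i) → κ i ≢ κ j
    path i j l e κ≡ = parity-suc (toℕ i ∸ suc m) (trans (sym (colour-path a (suc m) l))
      (trans (g≡ {i} {j} κ≡)
        (trans (cong g e) (trans (colour-path a (suc m) (m≤n⇒m≤1+n l)) (cong parity (+-∸-assoc 1 l))))))

-- Moves between contents and the resulting obstruction

infix 4 _⟶_
-- The arbitrary tail `z` will be the zeros that pad a content to length m + n, so one move on four
-- blocks serves every m and n.
record _⟶_ (α β : List ℕ) : Set where
  constructor arrow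
  field
    transport : ∀ z q → 0 < K q (α ++ z) → 0 < K q (β ++ z)
open _⟶_

permute : ∀ {α β} → α ↭ β → α ⟶ β
permute p .transport z q = subst (0 <_) (K-↭ (++⁺ʳ z p) q)

balance : ∀ {a b α} → b < a → suc a ∷ b ∷ α ⟶ a ∷ suc b ∷ α
balance {a} {b} {α} l .transport z q = K-balance {q} {a} {b} {α ++ z} l

infixr 5 _then_
_then_ : ∀ {α β γ} → α ⟶ β → β ⟶ γ → α ⟶ γ
(f then g) .transport z q = g .transport z q ∘ f .transport z q

-- The source of the move is always the type of a stable partition, by `stable`; b = 0 leaves the
-- independent vertices in one block. A fan is therefore excluded once the target is refuted.
fan-obstruction : ∀ j e M N β i a b {m n p p′} → m ≡ ⟦_⟧ j e M → n ≡ ⟦_⟧ j e N → a + b ≡ m → 1 ≤ m → 4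
  ≤ m + n →
  ⌈ n /2⌉ ≡ p → ⌊ n /2⌋ ≡ p′ → length (map (⟦_⟧ j e) β ++ replicate i 0) ≡ 4 →
  p ∷ p′ ∷ a ∷ b ∷ [] ⟶ map (⟦_⟧ j e) β ++ replicate i 0 →
  refute M N β (0 , 0 , 0) (0 , 0 , 0) 0 ≡ true → ¬ FanPositive m n
fan-obstruction j e M N β i a b {suc m} {n} eM eN ab _ l refl refl len move r (fanPositive positive) =
  support-obstruction {G = fan (suc m) n} (at α ∘ toℕ) (at γ ∘ toℕ)
    (λ q → subst₂ (λ x y → 0 < K q x → 0 < K q y)
      (sym (tabulate-at-zeros (suc m + n) α l))
      (sym (subst (λ w → tabulate {n = suc m + n} (at γ ∘ toℕ) ≡ γ ++ replicate (suc m + n ∸ w) 0) len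
        (tabulate-at-zeros (suc m + n) γ len′)))
      (move .transport (replicate (suc m + n ∸ 4) 0) q))
    (stable a b m n ab l)
    (unstable (suc m) n (map (⟦_⟧ j e) β) i len′ λ {k} p → refuted j e M N β r {k}
      (subst₂ (λ x y → Pick y (map (⟦_⟧ j e) β) x y k) eM eN p)) positive
  where
    α = ⌈ n /2⌉ ∷ ⌊ n /2⌋ ∷ a ∷ b ∷ []
    γ = map (⟦_⟧ j e) β ++ replicate i 0
    len′ = ≤-trans (≤-reflexive len) l

-- The remaining fans (m is compared with k, where n is k + k or 1 + (k + k))

private
  variable
    a b c d : ℕ

  132↭ : a ∷ b ∷ c ∷ d ∷ [] ↭ a ∷ c ∷ b ∷ d ∷ []
  132↭ {a} {b} {c} = Perm.prep a (Perm.swap b c ↭-refl)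

  312↭ : a ∷ b ∷ c ∷ d ∷ [] ↭ c ∷ a ∷ b ∷ d ∷ []
  312↭ {a} {b} {c} = ↭-trans 132↭ (Perm.swap a c ↭-refl)

⌈k+k/2⌉ : ∀ k → ⌈ k + k /2⌉ ≡ k
⌈k+k/2⌉ k = sym (n≡⌈n+n/2⌉ k)

⌊k+k/2⌋ : ∀ k → ⌊ k + k /2⌋ ≡ k
⌊k+k/2⌋ k = sym (n≡⌊n+n/2⌋ k)

-- The target is (m - 1, 2): no block of size 1 is left for the single path vertex.
large-m-n≡1 : ∀ e → ¬ FanPositive (3 + e) 1
large-m-n≡1 e = fan-obstruction 0 e (3 , 0 , 1) (1 , 0 , 0) ((2 , 0 , 1) ∷ (2 , 0 , 0) ∷ []) 2 (3 + e) 0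
  refl refl (+-identityʳ (3 + e)) (s≤s z≤n) (s≤s (s≤s (s≤s (m≤n+m 1 e)))) refl refl refl
  (permute 312↭ then balance (s≤s (s≤s z≤n))) refl

-- Here m ≥ k + 2 and the target is (m - 1, k + 1, k). Path blocks have at most k vertices, so only
-- the last block could lie on the path, which has 2 k vertices.
large-m-even : ∀ j e → let k = 1 + j in ¬ FanPositive (3 + (j + e)) (k + k)
large-m-even j e = fan-obstruction j e (3 , 1 , 1) (2 , 2 , 0)
  ((2 , 1 , 1) ∷ (2 , 1 , 0) ∷ (1 , 1 , 0) ∷ []) 1 (3 + (j + e)) 0
  refl (eq j) (+-identityʳ (3 + (j + e))) (s≤s z≤n)
    (s≤s (s≤s (s≤s (≤-trans (s≤s z≤n) (m≤n+m _ (j + e))))))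
  (⌈k+k/2⌉ (1 + j)) (⌊k+k/2⌋ (1 + j)) refl
  (permute 312↭ then balance (s≤s (s≤s (m≤m+n j e)))) refl
  where
    eq : ∀ j → 1 + j + (1 + j) ≡ 2 + (j + j)
    eq = solve-∀

-- Here k ≥ m + 2 and the target is (k - 1, m + 1, k): every block is larger than m, so none fits
-- among the independent vertices.
small-m-even : ∀ j e → let k = 3 + (j + e) in ¬ FanPositive (1 + e) (k + k)
small-m-even j e = fan-obstruction j e (1 , 0 , 1) (6 , 2 , 2)
  ((2 , 1 , 1) ∷ (2 , 0 , 1) ∷ (3 , 1 , 1) ∷ []) 1 (1 + e) 0
  refl (eq j e) (+-identityʳ (1 + e)) (s≤s z≤n) (s≤s (≤-trans (s≤s (s≤s (s≤s z≤n))) (m≤n+m _ e)))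
  (⌈k+k/2⌉ (3 + (j + e))) (⌊k+k/2⌋ (3 + (j + e))) refl
  (permute 132↭ then balance (s≤s (s≤s (m≤n+m e j)))) refl
  where
    eq : ∀ j e → 3 + (j + e) + (3 + (j + e)) ≡ 6 + (j + j + (e + e))
    eq = solve-∀

-- Here m ≥ k + 2 and the target is (m - 1, k + 1, k + 1). The path needs at least two blocks, but
-- all blocks have at least k + 1 vertices and the path only 2 k + 1.
large-m-odd : ∀ j e → let k = 1 + j in ¬ FanPositive (3 + (j + e)) (1 + (k + k))
large-m-odd j e = fan-obstruction j e (3 , 1 , 1) (3 , 2 , 0)
  ((2 , 1 , 1) ∷ (2 , 1 , 0) ∷ (2 , 1 , 0) ∷ []) 1 (3 + (j + e)) 0
  refl (eq j) (+-identityʳ (3 + (j + e))) (s≤s z≤n)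
    (s≤s (s≤s (s≤s (≤-trans (s≤s z≤n) (m≤n+m _ (j + e))))))
  (cong suc (⌊k+k/2⌋ (1 + j))) (⌈k+k/2⌉ (1 + j)) refl
  (permute 312↭ then permute (Perm.prep _ (Perm.swap _ _ ↭-refl)) then balance
    (s≤s (s≤s (m≤m+n j e)))) refl
  where
    eq : ∀ j → 1 + (1 + j + (1 + j)) ≡ 3 + (j + j)
    eq = solve-∀

-- Here k > m and the target is (k, m + 1, k): again every block is larger than m.
small-m-odd : ∀ j e → let k = 2 + (j + e) in ¬ FanPositive (1 + e) (1 + (k + k))
small-m-odd j e = fan-obstruction j e (1 , 0 , 1) (5 , 2 , 2)
  ((2 , 1 , 1) ∷ (2 , 0 , 1) ∷ (2 , 1 , 1) ∷ []) 1 (1 + e) 0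
  refl (eq j e) (+-identityʳ (1 + e)) (s≤s z≤n) (s≤s (≤-trans (s≤s (s≤s (s≤s z≤n))) (m≤n+m _ e)))
  (cong suc (⌊k+k/2⌋ (2 + (j + e)))) (⌈k+k/2⌉ (2 + (j + e))) refl
  (permute 132↭ then balance (s≤s (s≤s (m≤n+m e j)))) refl
  where
    eq : ∀ j e → 1 + (2 + (j + e) + (2 + (j + e))) ≡ 5 + (j + j + (e + e))
    eq = solve-∀

-- For m close to n/2 the sizes m and the two halves differ by at most 1, so no balancing among them
-- is possible. The independent vertices therefore start as 2 + (m - 2), and the small block grows
-- at the expense of the path. The target is (k - 1, k - 1, k - 1, 3); as m = k ≥ 4, no blocks add
-- up to m.
m≡k-even : ∀ j → let k = 4 + j in ¬ FanPositive k (k + k)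
m≡k-even j = fan-obstruction j 0 (4 , 1 , 0) (8 , 2 , 0)
  ((3 , 1 , 0) ∷ (3 , 1 , 0) ∷ (3 , 1 , 0) ∷ (3 , 0 , 0) ∷ []) 0 2 (2 + j)
  refl (eq j) refl (s≤s z≤n) (s≤s (s≤s (s≤s (s≤s z≤n)))) (⌈k+k/2⌉ (4 + j)) (⌊k+k/2⌋ (4 + j)) refl
  (permute 132↭ then balance (s≤s (s≤s (s≤s z≤n))) then
   permute (↭-trans (Perm.prep _ (Perm.swap _ _ ↭-refl))
     (↭-trans (Perm.swap _ _ ↭-refl)
     (Perm.prep _ (↭-trans (Perm.prep _ (Perm.swap _ _ ↭-refl)) (Perm.swap _ _ ↭-refl))))) then
   balance ≤-refl) refl
  where
    eq : ∀ j → 4 + j + (4 + j) ≡ 8 + (j + j)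
    eq = solve-∀

-- The target is (k - 1, 3, k, k - 1). For m = k + 1 single blocks are too small and, as k ≥ 4, two
-- blocks too large.
m≡1+k-even : ∀ j → let k = 4 + j in ¬ FanPositive (1 + k) (k + k)
m≡1+k-even j = fan-obstruction j 0 (5 , 1 , 0) (8 , 2 , 0)
  ((3 , 1 , 0) ∷ (3 , 0 , 0) ∷ (4 , 1 , 0) ∷ (3 , 1 , 0) ∷ []) 0 2 (3 + j)
  refl (eq j) refl (s≤s z≤n) (s≤s (s≤s (s≤s (s≤s z≤n)))) (⌈k+k/2⌉ (4 + j)) (⌊k+k/2⌋ (4 + j)) refl
  (permute 132↭ then balance (s≤s (s≤s (s≤s z≤n)))) refl
  where
    eq : ∀ j → 4 + j + (4 + j) ≡ 8 + (j + j)
    eq = solve-∀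

-- Here m is `k` and the halves of the path have m + 1 vertices. The target is (m - 1, m - 1, 3, m +
-- 1); as m ≥ 4, no blocks add up to m.
1+m≡k-even : ∀ j → let k = 4 + j in ¬ FanPositive k (1 + k + (1 + k))
1+m≡k-even j = fan-obstruction j 0 (4 , 1 , 0) (10 , 2 , 0)
  ((3 , 1 , 0) ∷ (3 , 1 , 0) ∷ (3 , 0 , 0) ∷ (5 , 1 , 0) ∷ []) 0 2 (2 + j)
  refl (eq j) refl (s≤s z≤n) (s≤s (s≤s (s≤s (s≤s z≤n)))) (⌈k+k/2⌉ (5 + j)) (⌊k+k/2⌋ (5 + j)) refl
  (permute 132↭ then balance (s≤s (s≤s (s≤s z≤n))) then
   permute (Perm.prep _ (↭-trans (Perm.prep _ (Perm.swap _ _ ↭-refl))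
     (Perm.swap _ _ ↭-refl))) then balance ≤-refl) refl
  where
    eq : ∀ j → 5 + j + (5 + j) ≡ 10 + (j + j)
    eq = solve-∀

-- The target is (k - 1, k - 1, k + 1, 2); as m = k ≥ 3, no blocks add up to m.
m≡k-odd : ∀ j → let k = 3 + j in ¬ FanPositive k (1 + (k + k))
m≡k-odd j = fan-obstruction j 0 (3 , 1 , 0) (7 , 2 , 0)
  ((2 , 1 , 0) ∷ (2 , 1 , 0) ∷ (4 , 1 , 0) ∷ (2 , 0 , 0) ∷ []) 0 2 (1 + j)
  refl (eq j) refl (s≤s z≤n) (s≤s (s≤s (s≤s (≤-trans (s≤s z≤n) (m≤n+m _ j)))))
  (cong suc (⌊k+k/2⌋ (3 + j))) (⌈k+k/2⌉ (3 + j)) refl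
  (permute (↭-trans (Perm.swap _ _ ↭-refl)
    (Perm.prep _ (↭-trans (Perm.prep _ (Perm.swap _ _ ↭-refl)) (Perm.swap _ _ ↭-refl)))) then
   balance ≤-refl) refl
  where
    eq : ∀ j → 1 + (3 + j + (3 + j)) ≡ 7 + (j + j)
    eq = solve-∀

-- Splitting off a single independent vertex suffices: the target is (k, 2, k, k), and for m = k + 1
-- with k ≥ 2 no blocks add up to m.
m≡1+k-odd : ∀ j → let k = 2 + j in ¬ FanPositive (1 + k) (1 + (k + k))
m≡1+k-odd j = fan-obstruction j 0 (3 , 1 , 0) (5 , 2 , 0)
  ((2 , 1 , 0) ∷ (2 , 0 , 0) ∷ (2 , 1 , 0) ∷ (2 , 1 , 0) ∷ []) 0 1 (2 + j)
  refl (eq j) refl (s≤s z≤n) (s≤s (s≤s (s≤s (≤-trans (s≤s z≤n) (m≤n+m _ j)))))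
  (cong suc (⌊k+k/2⌋ (2 + j))) (⌈k+k/2⌉ (2 + j)) refl
  (permute 132↭ then balance (s≤s (s≤s z≤n))) refl
  where
    eq : ∀ j → 1 + (2 + j + (2 + j)) ≡ 5 + (j + j)
    eq = solve-∀

-- The three exceptional fans, by linear inequalities

weighted : ∀ N → List (ℕ × List ℕ) → List (ℕ × (Fin N → ℕ))
weighted N = map λ (w , a) → w , at a ∘ toℕ

total : (List ℕ → ℕ) → List (ℕ × List ℕ) → ℕ
total f = sum ∘ map λ (w , a) → w * f a

pad : ℕ → List ℕ → List ℕ
pad N a = tabulate {n = N} (at a ∘ toℕ)

fanCoeff : ℕ → ℕ → List ℕ → ℕ
fanCoeff m n a = fanCount m n (vec (m + n) a) (vec (m + n) a)

checkLinear : (m n : ℕ) → (as bs : List (ℕ × List ℕ)) → Bool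
checkLinear m n as bs =
  allᵇ (λ q → total (K q ∘ pad N) as ≤ᵇ total (K q ∘ pad N) bs) (parts N N N)
  ∧ (suc (total (fanCoeff m n) bs) ≤ᵇ total (fanCoeff m n) as)
  where N = m + n

check-linear : ∀ m n as bs → 1 ≤ m → checkLinear m n as bs ≡ true → ¬ FanPositive m n
check-linear (suc m) n as bs _ e (fanPositive positive) =
  linear-obstruction {G = fan (suc m) n} (weighted N as) (weighted N bs)
  (All.map (λ {q} t → subst₂ _≤_ (sym (weigh-K q as)) (sym (weigh-K q bs)) (≤ᵇ-true t))
    (allᵇ-true (parts N N N) (proj₁ both)))
  (subst₂ _<_ (sym (weigh-X bs)) (sym (weigh-X as)) (≤ᵇ-true (proj₂ both))) positive
  where
    N = suc m + n
    both = ∧-true {allᵇ (λ q → total (K q ∘ pad N) as ≤ᵇ total (K q ∘ pad N) bs) (parts N N N)} e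
    weigh-K : ∀ q as → weigh {m + n} {fan (suc m) n} (K q ∘ tabulate) (weighted N as) ≡ total
      (K q ∘ pad N) as
    weigh-K q [] = refl
    weigh-K q ((w , a) ∷ as) = cong (w * K q (pad N a) +_) (weigh-K q as)
    weigh-X : ∀ as → weigh {m + n} {fan (suc m) n} (coeffX (fan (suc m) n)) (weighted N as) ≡ total
      (fanCoeff (suc m) n) as
    weigh-X [] = refl
    weigh-X ((w , a) ∷ as) = cong₂ _+_ (cong (w *_) (coeffX-fan (suc m) n (at a ∘ toℕ))) (weigh-X as)

-- In dominance order (3,2,2,1,1) lies between the other two contents. For every shape of size 9,
-- five times its Kostka number is at most the combination of theirs with weights 2 and 4; the
-- coefficients of X_G violate this.
fan-3-6 : ¬ FanPositive 3 6
fan-3-6 = check-linear 3 6 ((5 , 3 ∷ 2 ∷ 2 ∷ 1 ∷ 1 ∷ []) ∷ [])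
  ((2 , 2 ∷ 2 ∷ 2 ∷ 2 ∷ 1 ∷ []) ∷ (4 , 3 ∷ 3 ∷ 1 ∷ 1 ∷ 1 ∷ []) ∷ []) (s≤s z≤n) refl

-- (3,3,3,1) dominates (3,3,2,2), so its Kostka numbers are no larger. Its coefficient in X_G is
-- larger all the same, 24 against 12: the independent vertices are divided as 3 + 1 in the first
-- case and as 2 + 2 in the second.
fan-4-6 : ¬ FanPositive 4 6
fan-4-6 = check-linear 4 6 ((1 , 3 ∷ 3 ∷ 3 ∷ 1 ∷ []) ∷ []) ((1 , 3 ∷ 3 ∷ 2 ∷ 2 ∷ []) ∷ [])
  (s≤s z≤n) refl

-- The same comparison, with coefficients 28 and 24: two colours can serve the independent vertices
-- for (4,3,3,1), but only one for (4,3,2,2).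
fan-3-8 : ¬ FanPositive 3 8
fan-3-8 = check-linear 3 8 ((1 , 4 ∷ 3 ∷ 3 ∷ 1 ∷ []) ∷ []) ((1 , 4 ∷ 3 ∷ 2 ∷ 2 ∷ []) ∷ [])
  (s≤s z≤n) refl

-- Case distinction by the position of m relative to half of n

Listed : ℕ → ℕ → Set
Listed m n = (m ≡ 1 × n ≤ 4) ⊎ (m ≡ 2 × n ≤ 6) ⊎ (m ≡ 3 × n ≡ 4)

listed-positive : ∀ m n → 1 ≤ n → Listed m n → FanPositive m n
listed-positive .1 1 _ (inj₁ (refl , _)) = fan-1-1
listed-positive .1 2 _ (inj₁ (refl , _)) = fan-1-2
listed-positive .1 3 _ (inj₁ (refl , _)) = fan-1-3
listed-positive .1 4 _ (inj₁ (refl , _)) = fan-1-4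
listed-positive .1 (suc (suc (suc (suc (suc n))))) _ (inj₁ (refl , s≤s (s≤s (s≤s (s≤s ())))))
listed-positive .2 1 _ (inj₂ (inj₁ (refl , _))) = fan-2-1
listed-positive .2 2 _ (inj₂ (inj₁ (refl , _))) = fan-2-2
listed-positive .2 3 _ (inj₂ (inj₁ (refl , _))) = fan-2-3
listed-positive .2 4 _ (inj₂ (inj₁ (refl , _))) = fan-2-4
listed-positive .2 5 _ (inj₂ (inj₁ (refl , _))) = fan-2-5
listed-positive .2 6 _ (inj₂ (inj₁ (refl , _))) = fan-2-6
listed-positive .2 (suc (suc (suc (suc (suc (suc (suc n))))))) _
  (inj₂ (inj₁ (refl , s≤s (s≤s (s≤s (s≤s (s≤s (s≤s ()))))))))
listed-positive .3 .4 _ (inj₂ (inj₂ (refl , refl))) = fan-3-4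

Classified : ℕ → ℕ → Set
Classified m n = Listed m n ⊎ ¬ FanPositive m n

pattern listed₁ p = inj₁ (inj₁ (refl , p))
pattern listed₂ p = inj₁ (inj₂ (inj₁ (refl , p)))
pattern listed₃ = inj₁ (inj₂ (inj₂ (refl , refl)))

data Position (m k : ℕ) : Set where
  smaller : ∀ d → k ≡ suc (d + m) → Position m k
  same : k ≡ m → Position m k
  larger : ∀ d → m ≡ suc (d + k) → Position m k

position : ∀ m k → Position m k
position m k with compare m k
... | less m d = smaller d (cong suc (+-comm m d))
... | equal m = same refl
... | greater k d = larger d (cong suc (+-comm k d))

even-smaller : ∀ d m → 1 ≤ m → Classified m (suc (d + m) + suc (d + m))
even-smaller 0 1 _ = listed₁ (s≤s (s≤s (s≤s (s≤s z≤n))))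
even-smaller 0 2 _ = listed₂ (s≤s (s≤s (s≤s (s≤s (s≤s (s≤s z≤n))))))
even-smaller 0 3 _ = inj₂ fan-3-8
even-smaller 0 (suc (suc (suc (suc j)))) _ = inj₂ (1+m≡k-even j)
even-smaller (suc d) (suc e) _ rewrite +-suc d e = inj₂ (small-m-even d e)

even-same : ∀ k → 1 ≤ k → Classified k (k + k)
even-same 1 _ = listed₁ (s≤s (s≤s z≤n))
even-same 2 _ = listed₂ (s≤s (s≤s (s≤s (s≤s z≤n))))
even-same 3 _ = inj₂ fan-3-6
even-same (suc (suc (suc (suc j)))) _ = inj₂ (m≡k-even j)

even-larger : ∀ d k → 1 ≤ k → Classified (suc (d + k)) (k + k)
even-larger 0 1 _ = listed₂ (s≤s (s≤s z≤n))
even-larger 0 2 _ = listed₃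
even-larger 0 3 _ = inj₂ fan-4-6
even-larger 0 (suc (suc (suc (suc j)))) _ = inj₂ (m≡1+k-even j)
even-larger (suc d) (suc j) _ rewrite +-suc d j | +-comm d j = inj₂ (large-m-even j d)

odd-smaller : ∀ d m → 1 ≤ m → Classified m (suc (suc (d + m) + suc (d + m)))
odd-smaller d (suc e) _ rewrite +-suc d e = inj₂ (small-m-odd d e)

odd-same : ∀ k → 1 ≤ k → Classified k (suc (k + k))
odd-same 1 _ = listed₁ (s≤s (s≤s (s≤s z≤n)))
odd-same 2 _ = listed₂ (s≤s (s≤s (s≤s (s≤s (s≤s z≤n)))))
odd-same (suc (suc (suc j))) _ = inj₂ (m≡k-odd j)

odd-larger : ∀ d k → Classified (suc (d + k)) (suc (k + k))
odd-larger 0 0 = listed₁ (s≤s z≤n)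
odd-larger 1 0 = listed₂ (s≤s z≤n)
odd-larger (suc (suc d)) 0 rewrite +-identityʳ d = inj₂ (large-m-n≡1 d)
odd-larger 0 1 = listed₂ (s≤s (s≤s (s≤s z≤n)))
odd-larger 0 (suc (suc j)) = inj₂ (m≡1+k-odd j)
odd-larger (suc d) (suc j) rewrite +-suc d j | +-comm d j = inj₂ (large-m-odd j d)

data Halves : ℕ → Set where
  even : ∀ k → Halves (k + k)
  odd : ∀ k → Halves (suc (k + k))

halves : ∀ n → Halves n
halves zero = even 0
halves (suc n) with halves n
... | even k = odd k
... | odd k = subst Halves (cong suc (+-suc k k)) (even (suc k))

classify : ∀ m n → 1 ≤ m → 1 ≤ n → Classified m n
classify m n 1≤m 1≤n with halves n
... | even (suc k) with position m (suc k)
...   | smaller d refl = even-smaller d m 1≤m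
...   | same refl = even-same (suc k) (s≤s z≤n)
...   | larger d refl = even-larger d (suc k) (s≤s z≤n)
classify m n 1≤m 1≤n | odd k with position m k
...   | smaller d refl = odd-smaller d m 1≤m
...   | same refl = odd-same k 1≤m
...   | larger d refl = odd-larger d k

theorem3p6 : (m n : ℕ) → 1 ≤ m → 1 ≤ n →
    (SchurPositive (fan m n) ⇔
    ((m ≡ 1 × n ≤ 4) ⊎ (m ≡ 2 × n ≤ 6) ⊎ (m ≡ 3 × n ≡ 4)))
theorem3p6 m n 1≤m 1≤n = mk⇔ forward (FanPositive.schurPositive ∘ listed-positive m n 1≤n)
  where
    forward : SchurPositive (fan m n) → Listed m n
    forward p with classify m n 1≤m 1≤n
    ... | inj₁ l = l
    ... | inj₂ ¬p = ⊥-elim (¬p (fanPositive p))
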